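{- Let $n\geq 2$ and let $G=S_n(a_1,a_2,\dots,a_n)$ be a palm. Then $$\left\lceil\log_3\left(\frac{n}{4}\right)\right\rceil+3\leq\chi_L(G)\leq n+1.$$ Moreover, for every integer $k$ with $\left\lceil\log_3\left(\frac{n}{4}\right)\right\rceil+3\leq k\leq n+1$ there exists a palm $G=S_n(a_1,\dots,a_n)$ (for some positive integers $a_1,\dots,a_n$) with $\chi_L(G)=k$.
   Context: For a simple connected graph $G=(V,E)$, a $k$-coloring is a map $c:V\to\{1,\dots,k\}$ with adjacent vertices receiving different colors; $c^{ -1}(i)$ denotes the $i$-th color class, and $d(u,S)=\min_{v\in S}d(u,v)$. The color code of $v$ is $r_c(v)=(d(v,c^{ -1}(1)),\dots,d(v,c^{ -1}(k)))$. The coloring $c$ is a locating coloring if distinct vertices have distinct color codes. The locating chromatic number $\chi_L(G)$ is the least $k$ such that $G$ has a locating $k$-coloring. For $n\geq 2$ and positive integers $a_1,\dots,a_n$, the palm $S_n(a_1,\dots,a_n)$ is the tree obtained from the star with center (hub) $a_0$ and $n$ leaves by subdividing its $i$-th edge $a_i-1$ times, i.e. it consists of $n$ paths of lengths $a_1,\dots,a_n$ sharing the common endpoint $a_0$. -}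

module Defs where

open import Data.Nat using (ℕ; zero; suc; _+_; _*_; _^_; _≤_; _<_)
open import Data.Fin using (Fin; toℕ)
open import Data.Maybe using (Maybe; just; nothing)
open import Data.Product using (Σ; Σ-syntax; ∃-syntax; _×_; _,_)
open import Data.Sum using (_⊎_)
open import Relation.Binary.PropositionalEquality using (_≡_; _≢_)
open import Relation.Nullary using (¬_)

record Graph : Set₁ where
  field
    V   : Set
    Adj : V → V → Set
open Graph public

data Walk (G : Graph) : V G → V G → ℕ → Set where
  here : ∀ {u} → Walk G u u 0
  step : ∀ {u w v m} → Adj G u w → Walk G w v m → Walk G u v (suc m)

WalkToSet : (G : Graph) → V G → (V G → Set) → ℕ → Set
WalkToSet G u S m = Σ[ v ∈ V G ] (S v × Walk G u v m)

DistToSet : (G : Graph) → V G → (V G → Set) → ℕ → Set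
DistToSet G u S m = WalkToSet G u S m × (∀ m' → m' < m → ¬ WalkToSet G u S m')

IsColoring : (G : Graph) (k : ℕ) → (V G → Fin k) → Set
IsColoring G k c = ∀ u v → Adj G u v → c u ≢ c v

ColorClass : (G : Graph) (k : ℕ) → (V G → Fin k) → Fin k → V G → Set
ColorClass G k c i v = c v ≡ i

-- the color codes r_c(u), r_c(v) differ: some coordinate differs
-- (an empty color class gives the undefined distance at both vertices)
CodesDiffer : (G : Graph) (k : ℕ) → (V G → Fin k) → V G → V G → Set
CodesDiffer G k c u v =
  Σ[ i ∈ Fin k ] Σ[ m ∈ ℕ ]
    ((DistToSet G u (ColorClass G k c i) m × ¬ DistToSet G v (ColorClass G k c i) m)
     ⊎ (¬ DistToSet G u (ColorClass G k c i) m × DistToSet G v (ColorClass G k c i) m))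

IsLocatingColoring : (G : Graph) (k : ℕ) → (V G → Fin k) → Set
IsLocatingColoring G k c =
  IsColoring G k c × (∀ u v → u ≢ v → CodesDiffer G k c u v)

HasLocatingColoring : Graph → ℕ → Set
HasLocatingColoring G k = Σ[ c ∈ (V G → Fin k) ] IsLocatingColoring G k c

IsLocChromNum : Graph → ℕ → Set
IsLocChromNum G k =
  HasLocatingColoring G k × (∀ k' → k' < k → ¬ HasLocatingColoring G k')

-- Palms S_n(a_1,…,a_n)
-- vertices: the hub (nothing) and, for leg i, the vertices just (i , j)
-- with j : Fin (a i), where (i , j) is at distance toℕ j + 1 from the hub.

PalmV : (n : ℕ) → (Fin n → ℕ) → Set
PalmV n a = Maybe (Σ[ i ∈ Fin n ] Fin (a i))

data PalmArc (n : ℕ) (a : Fin n → ℕ) : PalmV n a → PalmV n a → Set where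
  hub-leg : ∀ i (j : Fin (a i)) → toℕ j ≡ 0 → PalmArc n a nothing (just (i , j))
  leg-leg : ∀ i (j j' : Fin (a i)) → toℕ j' ≡ suc (toℕ j) →
            PalmArc n a (just (i , j)) (just (i , j'))

Palm : (n : ℕ) → (Fin n → ℕ) → Graph
Palm n a = record
  { V   = PalmV n a
  ; Adj = λ u v → PalmArc n a u v ⊎ PalmArc n a v u }

-- t = ⌈log₃ (n/4)⌉ for n ≥ 2 (then t ≥ 0): the least t with n ≤ 4·3^t

IsCeilLog3Quarter : ℕ → ℕ → Set
IsCeilLog3Quarter n t = n ≤ 4 * 3 ^ t × (∀ s → s < t → 4 * 3 ^ s < n)

{-# OPTIONS --safe #-}
module Submission where

-- In a tree all distances are explicit, so "u and v have the same color code" becomes: every vertex w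
-- can be replaced by some w' of the same color with d(v,w') ≤ d(u,w), and conversely. This is decidable,
-- so χ_L of a palm can be computed by exhaustive search.
--
-- Upper bound: color the hub 0 and let the i-th leg alternate i,0,i,0,…
--
-- Lower bound: the code of a neighbor v of the hub differs from that of the hub by -1, 0 or 1 in each
-- coordinate. Among the s colors at distance 1 from the hub exactly one coordinate of v drops to 0, so
-- k = m+1 colors serve at most s·2^(s-1)·3^(m-s) ≤ (4/9)·3^m legs.
--
-- Intermediate values: changing the length of a single leg changes χ_L by at most 1, since the leg may be
-- recolored by a new color alternating with the hub color. Lengthening the legs of a star (χ_L = n+1) one
-- by one ends in a palm with long legs, and this palm has a locating coloring with t+3 colors as soon as
-- n ≤ 4·3^t: each of the t extra colors sits at depth D or D+1 on a leg, or is absent from it, which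
-- yields 3^t patterns, and there are four fillers for the rest of the leg.

open import Defs
open import Data.Bool using (Bool; T; true; false; not; if_then_else_)
open import Data.Bool.Properties using (not-involutive; ¬-not) renaming (_≟_ to _≟ᵇ_)
open import Data.Fin using (Fin; zero; suc; toℕ; fromℕ<; cast; combine; finToFun; funToFin; inject≤; join; punchIn; punchOut; remQuot; splitAt)
open import Data.Fin.Patterns using (0F; 1F; 2F; 3F)
open import Data.Fin.Properties using (toℕ-fromℕ<; toℕ-injective; toℕ<n; toℕ-cast; toℕ-combine; toℕ-inject≤; any?; all?; combine-injectiveˡ; combine-injectiveʳ; combine-remQuot; finToFun-funToFin; funToFin-finToFin; inject≤-injective; injective⇒≤; punchIn-injective; punchIn-punchOut; remQuot-combine; splitAt-join) renaming (_≟_ to _≟ᶠ_; suc-injective to sucᶠ-injective)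
open import Data.List using (List; []; _∷_; _++_; length; map; cartesianProductWith; lookup)
open import Data.List.Membership.Propositional using (_∈_)
open import Data.List.Membership.Propositional.Properties using (∈-++⁺ˡ; ∈-++⁺ʳ; ∈-cartesianProductWith⁺)
open import Data.List.Properties using (length-++; length-map)
open import Data.List.Relation.Unary.Any using (here; there; index)
open import Data.List.Relation.Unary.Any.Properties using (lookup-index)
open import Data.Maybe using (Maybe; just; nothing)
open import Data.Maybe.Properties using (just-injective; ≡-dec)
open import Data.Nat
open import Data.Nat.Properties
open import Data.Nat.Tactic.RingSolver using (solve-∀)
open import Data.Product using (Σ-syntax; ∃; ∃-syntax; _×_; _,_; proj₁; proj₂)
open import Data.Sum using (_⊎_; inj₁; inj₂; swap)
open import Data.Sum.Properties using (inj₂-injective)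
open import Data.Vec using (Vec; []; _∷_; tabulate)
import Data.Vec as Vec
open import Data.Vec.Properties using (lookup∘tabulate)
open import Function using (_∘_; case_of_)
open import Relation.Binary.PropositionalEquality
open import Relation.Nullary
open import Relation.Nullary.Decidable using (map′; decidable-stable; ¬?; _×-dec_; _⊎-dec_; _→-dec_)

private
  variable
    n k m : ℕ
    a : Fin n → ℕ
    K L : Set

-- Distances in palms

∣m-n∣≤1+∣1+m-n∣ : ∀ m n → ∣ m - n ∣ ≤ suc ∣ suc m - n ∣
∣m-n∣≤1+∣1+m-n∣ zero    zero    = z≤n
∣m-n∣≤1+∣1+m-n∣ zero    (suc n) = ≤-refl
∣m-n∣≤1+∣1+m-n∣ (suc m) zero    = ≤-trans (n≤1+n _) (n≤1+n _)
∣m-n∣≤1+∣1+m-n∣ (suc m) (suc n) = ∣m-n∣≤1+∣1+m-n∣ m n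

∣1+m-n∣≤1+∣m-n∣ : ∀ m n → ∣ suc m - n ∣ ≤ suc ∣ m - n ∣
∣1+m-n∣≤1+∣m-n∣ m       zero    = s≤s (≤-reflexive (sym (∣-∣-identityʳ m)))
∣1+m-n∣≤1+∣m-n∣ zero    (suc n) = ≤-trans (n≤1+n _) (n≤1+n _)
∣1+m-n∣≤1+∣m-n∣ (suc m) (suc n) = ∣1+m-n∣≤1+∣m-n∣ m n

depth : PalmV n a → ℕ
depth nothing        = 0
depth (just (_ , j)) = suc (toℕ j)

dist : PalmV n a → PalmV n a → ℕ
dist nothing        v              = depth v
dist (just (_ , j)) nothing        = suc (toℕ j)
dist (just (i , j)) (just (i' , j')) with i ≟ᶠ i'
... | yes _ = ∣ toℕ j - toℕ j' ∣
... | no  _ = suc (toℕ j) + suc (toℕ j')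

dist-hubʳ : (u : PalmV n a) → dist u nothing ≡ depth u
dist-hubʳ nothing  = refl
dist-hubʳ (just _) = refl

dist-sameLeg : ∀ (a : Fin n → ℕ) i (j j' : Fin (a i)) →
               dist {n} {a} (just (i , j)) (just (i , j')) ≡ ∣ toℕ j - toℕ j' ∣
dist-sameLeg a i j j' with i ≟ᶠ i
... | yes _  = refl
... | no i≢i = contradiction refl i≢i

dist-diffLeg : ∀ (a : Fin n → ℕ) {i i'} (j : Fin (a i)) (j' : Fin (a i')) → i ≢ i' →
               dist {n} {a} (just (i , j)) (just (i' , j')) ≡ suc (toℕ j) + suc (toℕ j')
dist-diffLeg a {i} {i'} j j' i≢i' with i ≟ᶠ i'
... | yes i≡i' = contradiction i≡i' i≢i'
... | no _     = refl

dist-refl : (u : PalmV n a) → dist u u ≡ 0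
dist-refl nothing        = refl
dist-refl {a = a} (just (i , j)) = trans (dist-sameLeg a i j j) (∣n-n∣≡0 (toℕ j))

dist≤depth+depth : (u v : PalmV n a) → dist u v ≤ depth u + depth v
dist≤depth+depth nothing        v              = ≤-refl
dist≤depth+depth (just (i , j)) nothing        = m≤m+n _ _
dist≤depth+depth (just (i , j)) (just (i' , j')) with i ≟ᶠ i'
... | yes _ = ≤-trans (∣m-n∣≤m⊔n (toℕ j) (toℕ j'))
                (≤-trans (m⊔n≤m+n (toℕ j) (toℕ j')) (+-mono-≤ (n≤1+n _) (n≤1+n _)))
... | no _  = ≤-refl

dist≡0⇒≡ : {u v : PalmV n a} → dist u v ≡ 0 → u ≡ v
dist≡0⇒≡ {u = nothing}      {nothing}        _ = refl
dist≡0⇒≡ {u = nothing}      {just _}         ()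
dist≡0⇒≡ {u = just _}       {nothing}        ()
dist≡0⇒≡ {u = just (i , j)} {just (i' , j')} eq with i ≟ᶠ i'
... | yes refl = cong (λ z → just (i , z)) (toℕ-injective (∣m-n∣≡0⇒m≡n eq))
dist≡0⇒≡ {u = just (i , j)} {just (i' , j')} () | no _

-- A walk may follow an arc in either direction, so both inequalities are recorded.
dist-arc : {u w : PalmV n a} → PalmArc n a u w → ∀ v →
           dist u v ≤ suc (dist w v) × dist w v ≤ suc (dist u v)
dist-arc (hub-leg i j j≡0) nothing = z≤n , s≤s (≤-reflexive j≡0)
dist-arc (hub-leg i j j≡0) (just (i' , j')) with i ≟ᶠ i'
... | yes _ rewrite j≡0 = ≤-refl , ≤-trans (n≤1+n _) (n≤1+n _)
... | no _  rewrite j≡0 = ≤-trans (n≤1+n _) (n≤1+n _) , ≤-refl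
dist-arc (leg-leg i j j₁ eq) nothing rewrite eq = ≤-trans (n≤1+n _) (n≤1+n _) , ≤-refl
dist-arc (leg-leg i j j₁ eq) (just (i' , j')) with i ≟ᶠ i'
... | yes _ rewrite eq = ∣m-n∣≤1+∣1+m-n∣ (toℕ j) (toℕ j') , ∣1+m-n∣≤1+∣m-n∣ (toℕ j) (toℕ j')
... | no _  rewrite eq = ≤-trans (n≤1+n _) (n≤1+n _) , ≤-refl

dist≤walk : ∀ {u v : PalmV n a} {m} → Walk (Palm n a) u v m → dist u v ≤ m
dist≤walk {u = u} here = ≤-reflexive (dist-refl u)
dist≤walk {v = v} (step (inj₁ e) p) = ≤-trans (proj₁ (dist-arc e v)) (s≤s (dist≤walk p))
dist≤walk {v = v} (step (inj₂ e) p) = ≤-trans (proj₂ (dist-arc e v)) (s≤s (dist≤walk p))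

walk-++ : ∀ {u v w : PalmV n a} {l m} →
          Walk (Palm n a) u v l → Walk (Palm n a) v w m → Walk (Palm n a) u w (l + m)
walk-++ here       q = q
walk-++ (step e p) q = step e (walk-++ p q)

walk-reverse : ∀ {u v : PalmV n a} {m} → Walk (Palm n a) u v m → Walk (Palm n a) v u m
walk-reverse here = here
walk-reverse {m = suc m} (step e p) =
  subst (Walk _ _ _) (+-comm m 1) (walk-++ (walk-reverse p) (step (swap e) here))

walk-outward : ∀ {i} d (j j' : Fin (a i)) → toℕ j' ≡ d + toℕ j →
               Walk (Palm n a) (just (i , j)) (just (i , j')) d
walk-outward zero j j' eq rewrite toℕ-injective eq = here
walk-outward {a = a} {i} (suc d) j j' eq =
  step (inj₁ (leg-leg i j j⁺ eq⁺)) (walk-outward d j⁺ j' eq')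
  where
  j⁺<a : suc (toℕ j) < a i
  j⁺<a = ≤-<-trans (≤-trans (s≤s (m≤n+m (toℕ j) d)) (≤-reflexive (sym eq))) (toℕ<n j')
  j⁺ : Fin (a i)
  j⁺ = fromℕ< j⁺<a
  eq⁺ : toℕ j⁺ ≡ suc (toℕ j)
  eq⁺ = toℕ-fromℕ< j⁺<a
  eq' : toℕ j' ≡ d + toℕ j⁺
  eq' = trans eq (trans (sym (+-suc d (toℕ j))) (cong (d +_) (sym eq⁺)))

walk-hub : ∀ {i} (j : Fin (a i)) → Walk (Palm n a) nothing (just (i , j)) (suc (toℕ j))
walk-hub {a = a} {i} j =
  step (inj₁ (hub-leg i j₀ eq₀))
       (walk-outward (toℕ j) j₀ j (sym (trans (cong (toℕ j +_) eq₀) (+-identityʳ _))))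
  where
  0<a : 0 < a i
  0<a = ≤-<-trans z≤n (toℕ<n j)
  j₀ : Fin (a i)
  j₀ = fromℕ< 0<a
  eq₀ : toℕ j₀ ≡ 0
  eq₀ = toℕ-fromℕ< 0<a

-- With `dist≤walk` this identifies `dist` with the graph distance.
geodesic : (u v : PalmV n a) → Walk (Palm n a) u v (dist u v)
geodesic nothing        nothing        = here
geodesic nothing        (just (i , j)) = walk-hub j
geodesic (just (i , j)) nothing        = walk-reverse (walk-hub j)
geodesic (just (i , j)) (just (i' , j')) with i ≟ᶠ i'
... | no _ = walk-++ (walk-reverse (walk-hub j)) (walk-hub j')
... | yes refl with ≤-total (toℕ j) (toℕ j')
...   | inj₁ j≤j' = walk-outward _ j j'
          (sym (trans (cong (_+ toℕ j) (m≤n⇒∣m-n∣≡n∸m j≤j')) (m∸n+n≡m j≤j')))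
...   | inj₂ j'≤j = walk-reverse (walk-outward _ j' j
          (sym (trans (cong (_+ toℕ j') (m≤n⇒∣n-m∣≡n∸m j'≤j)) (m∸n+n≡m j'≤j))))

-- Color codes and the existence of χ_L

Proper : (PalmV n a → K) → Set
Proper {n} {a} c =
    (∀ i (j : Fin (a i)) → toℕ j ≡ 0 → c nothing ≢ c (just (i , j)))
  × (∀ i (j j' : Fin (a i)) → toℕ j' ≡ suc (toℕ j) → c (just (i , j)) ≢ c (just (i , j')))

-- In terms of color codes: every coordinate of r_c(v) is at most that of r_c(u).
Dominates : (PalmV n a → K) → PalmV n a → PalmV n a → Set
Dominates c u v = ∀ w → ∃[ w' ] (c w' ≡ c w × dist v w' ≤ dist u w)

-- Mutual domination is equality of color codes; an absent color constrains neither vertex. Any type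
-- may serve as the set of colors, so a new color can be adjoined before the colors are numbered.
Locating : (PalmV n a → K) → Set
Locating c = Proper c × (∀ u v → Dominates c u v → Dominates c v u → u ≡ v)

anyV? : {P : PalmV n a → Set} → (∀ v → Dec (P v)) → Dec (∃ P)
anyV? {P = P} P? = map′ to from (P? nothing ⊎-dec any? (λ i → any? (λ j → P? (just (i , j)))))
  where
  to : P nothing ⊎ (∃[ i ] ∃[ j ] P (just (i , j))) → ∃ P
  to (inj₁ p)           = nothing , p
  to (inj₂ (i , j , p)) = just (i , j) , p
  from : ∃ P → P nothing ⊎ (∃[ i ] ∃[ j ] P (just (i , j)))
  from (nothing , p)      = inj₁ p
  from (just (i , j) , p) = inj₂ (i , j , p)

allV? : {P : PalmV n a → Set} → (∀ v → Dec (P v)) → Dec (∀ v → P v)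
allV? {P = P} P? with anyV? (¬? ∘ P?)
... | yes (v , ¬p) = no λ all → ¬p (all v)
... | no ¬∃        = yes λ v → decidable-stable (P? v) (λ ¬p → ¬∃ (v , ¬p))

_≟ⱽ_ : (u v : PalmV n a) → Dec (u ≡ v)
u ≟ⱽ v = map′ dist≡0⇒≡ (λ { refl → dist-refl u }) (dist u v ≟ 0)

module _ (c : PalmV n a → Fin k) where

  dominated? : ∀ u v w → Dec (∃[ w' ] (c w' ≡ c w × dist v w' ≤ dist u w))
  dominated? u v w = anyV? λ w' → (c w' ≟ᶠ c w) ×-dec (dist v w' ≤? dist u w)

  dominates? : ∀ u v → Dec (Dominates c u v)
  dominates? u v = allV? (dominated? u v)

  proper? : Dec (Proper c)
  proper? =
          all? (λ i → all? λ j → (toℕ j ≟ 0) →-dec ¬? (c nothing ≟ᶠ c (just (i , j))))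
    ×-dec all? (λ i → all? λ j → all? λ j' →
            (toℕ j' ≟ suc (toℕ j)) →-dec ¬? (c (just (i , j)) ≟ᶠ c (just (i , j'))))

  locating? : Dec (Locating c)
  locating? = proper? ×-dec
    allV? (λ u → allV? λ v → dominates? u v →-dec (dominates? v u →-dec (u ≟ⱽ v)))

least : {P : ℕ → Set} → (∀ m → Dec (P m)) → ∀ b → P b →
        ∃[ m ] (m ≤ b × P m × (∀ m' → m' < m → ¬ P m'))
least P? zero    p = zero , ≤-refl , p , λ _ ()
least P? (suc b) p with P? zero
... | yes p₀ = zero , z≤n , p₀ , λ _ ()
... | no ¬p₀ with least (P? ∘ suc) b p
...   | m , m≤b , pm , min = suc m , s≤s m≤b , pm , λ where
        zero     _         → ¬p₀
        (suc m') (s≤s lt)  → min m' lt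

module _ (c : PalmV n a → Fin k) where

  private
    Class : Fin k → PalmV n a → Set
    Class = ColorClass (Palm n a) k c

  distToClass : ∀ u w → ∃[ m ] (m ≤ dist u w × DistToSet (Palm n a) u (Class (c w)) m)
  distToClass u w
    with least (λ m → anyV? λ w' → (c w' ≟ᶠ c w) ×-dec (dist u w' ≟ m)) (dist u w) (w , refl , refl)
  ... | m , m≤ , (w' , col , refl) , min = m , m≤ , (w' , col , geodesic u w') , none
    where
    none : ∀ m' → m' < m → ¬ WalkToSet (Palm n a) u (Class (c w)) m'
    none m' m'<m (w″ , col″ , p) =
      min _ (≤-<-trans (dist≤walk p) m'<m) (w″ , col″ , refl)

  sameDist : ∀ {u v i m} → Dominates c u v → Dominates c v u →
             DistToSet (Palm n a) u (Class i) m → DistToSet (Palm n a) v (Class i) m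
  sameDist {u} {v} {i} {m} u≥v v≥u ((w , refl , p) , min) with u≥v w
  ... | w' , col , d≤ = (w' , col , subst (Walk _ v w') d≡m (geodesic v w')) , none
    where
    none : ∀ m' → m' < m → ¬ WalkToSet (Palm n a) v (Class i) m'
    none m' m'<m (x , colx , q) with v≥u x
    ... | x' , colx' , d'≤ =
      min (dist u x') (≤-<-trans (≤-trans d'≤ (dist≤walk q)) m'<m)
          (x' , trans colx' colx , geodesic u x')
    d≡m : dist v w' ≡ m
    d≡m = ≤-antisym (≤-trans d≤ (dist≤walk p))
                    (≮⇒≥ λ lt → none _ lt (w' , col , geodesic v w'))

  -- Some w has no replacement. Its class is at distance m ≤ d(u,w) from u; were it at distance m
  -- from v as well, a vertex attaining that distance would replace w.
  notDominated⇒distsDiffer : ∀ {u v} → ¬ Dominates c u v →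
    ∃[ i ] ∃[ m ] (DistToSet (Palm n a) u (Class i) m × ¬ DistToSet (Palm n a) v (Class i) m)
  notDominated⇒distsDiffer {u} {v} ¬dom with anyV? (λ w → ¬? (dominated? c u v w))
  ... | no ¬∃ = contradiction
        (λ w → decidable-stable (dominated? c u v w) λ ¬d → ¬∃ (w , ¬d)) ¬dom
  ... | yes (w , ¬d) with distToClass u w
  ...   | m , m≤ , du = c w , m , du , λ where
          ((w' , col , p) , _) → ¬d (w' , col , ≤-trans (dist≤walk p) m≤)

  locating⇒isLocatingColoring : Locating c → IsLocatingColoring (Palm n a) k c
  locating⇒isLocatingColoring (proper , loc) = coloring , codes
    where
    arc : ∀ {u v} → PalmArc n a u v → c u ≢ c v
    arc (hub-leg i j eq)    = proj₁ proper i j eq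
    arc (leg-leg i j j' eq) = proj₂ proper i j j' eq
    coloring : IsColoring (Palm n a) k c
    coloring u v (inj₁ e) = arc e
    coloring u v (inj₂ e) = arc e ∘ sym
    codes : ∀ u v → u ≢ v → CodesDiffer (Palm n a) k c u v
    codes u v u≢v with dominates? c u v | dominates? c v u
    ... | yes u≥v | yes v≥u = contradiction (loc u v u≥v v≥u) u≢v
    ... | no ¬d | _ with notDominated⇒distsDiffer ¬d
    ...   | i , m , du , ¬dv = i , m , inj₁ (du , ¬dv)
    codes u v u≢v | yes _ | no ¬d with notDominated⇒distsDiffer ¬d
    ...   | i , m , dv , ¬du = i , m , inj₂ (¬du , dv)

  isLocatingColoring⇒locating : IsLocatingColoring (Palm n a) k c → Locating c
  isLocatingColoring⇒locating (coloring , codes) = proper , loc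
    where
    proper : Proper c
    proper = (λ i j eq → coloring _ _ (inj₁ (hub-leg i j eq)))
           , (λ i j j' eq → coloring _ _ (inj₁ (leg-leg i j j' eq)))
    loc : ∀ u v → Dominates c u v → Dominates c v u → u ≡ v
    loc u v u≥v v≥u = decidable-stable (u ≟ⱽ v) λ u≢v → differ (codes u v u≢v)
      where
      differ : ¬ CodesDiffer (Palm n a) k c u v
      differ (i , m , inj₁ (du , ¬dv)) = ¬dv (sameDist u≥v v≥u du)
      differ (i , m , inj₂ (¬du , dv)) = ¬du (sameDist v≥u u≥v dv)

-- Refining a coloring only makes domination harder. The main use is an injective renaming of
-- colors.
locating-reflect : {c : PalmV n a → K} {c' : PalmV n a → L} →
                   (∀ {u v} → c' u ≡ c' v → c u ≡ c v) → Locating c → Locating c'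
locating-reflect {c = c} {c'} back ((p₁ , p₂) , loc) =
  ((λ i j eq e → p₁ i j eq (back e)) , λ i j j' eq e → p₂ i j j' eq (back e)) ,
  λ u v u≥v v≥u → loc u v (lower u v u≥v) (lower v u v≥u)
  where
  lower : ∀ u v → Dominates c' u v → Dominates c u v
  lower u v u≥v w with u≥v w
  ... | w' , e , d = w' , back e , d

locating-≗ : {c c' : PalmV n a → K} → (∀ v → c v ≡ c' v) → Locating c → Locating c'
locating-≗ eq = locating-reflect λ {u} {v} e → trans (eq u) (trans e (sym (eq v)))

-- The search rebuilds a function only up to pointwise equality, which `P` therefore has to respect.
anyΠ? : ∀ {n} {b : Fin n → ℕ} {P : (∀ i → Fin (b i)) → Set} →
        (∀ {f g} → (∀ i → f i ≡ g i) → P f → P g) → (∀ f → Dec (P f)) → Dec (∃ P)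
anyΠ? {zero}  {b} {P} resp P? =
  map′ (λ p → _ , p) (λ (f , p) → resp (λ ()) p) (P? λ ())
anyΠ? {suc n} {b} {P} resp P? = map′ to from
  (any? λ x → anyΠ? (λ {f} {g} eq → resp {cons x f} {cons x g} λ { zero → refl ; (suc i) → eq i })
                    (λ f → P? (cons x f)))
  where
  cons : Fin (b zero) → (∀ i → Fin (b (suc i))) → ∀ i → Fin (b i)
  cons x f zero    = x
  cons x f (suc i) = f i
  to : (∃[ x ] ∃[ f ] P (cons x f)) → ∃ P
  to (x , f , p) = cons x f , p
  from : ∃ P → ∃[ x ] ∃[ f ] P (cons x f)
  from (f , p) = f zero , (f ∘ suc) , resp (λ { zero → refl ; (suc i) → refl }) p

-- A leg is coded by one number below `k ^ a i` whose base-`k` digits are the colors along it, which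
-- leaves finitely many codes to try.
hasLocating? : ∀ (a : Fin n → ℕ) k → Dec (∃[ c ] Locating {n} {a} {Fin k} c)
hasLocating? {n} a k = map′ to from
  (any? λ h → anyΠ? {b = λ i → k ^ a i}
    (λ eq → locating-≗ (λ { nothing → refl ; (just (i , j)) → cong (λ x → finToFun x j) (eq i) }))
    (λ f → locating? (decode h f)))
  where
  decode : Fin k → (∀ i → Fin (k ^ a i)) → PalmV n a → Fin k
  decode h f nothing        = h
  decode h f (just (i , j)) = finToFun (f i) j
  to : (∃[ h ] ∃[ f ] Locating (decode h f)) → ∃[ c ] Locating {n} {a} {Fin k} c
  to (h , f , l) = decode h f , l
  from : ∃[ c ] Locating {n} {a} {Fin k} c → ∃[ h ] ∃[ f ] Locating (decode h f)
  from (c , l) = c nothing , (λ i → funToFin (λ j → c (just (i , j)))) ,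
    locating-≗ (λ { nothing → refl ; (just (i , j)) → sym (finToFun-funToFin _ j) }) l

HasLocating : (n : ℕ) → (Fin n → ℕ) → ℕ → Set
HasLocating n a k = ∃[ c ] Locating {n} {a} {Fin k} c

-- Minimality appears twice: as in `IsLocChromNum`, and as a lower bound over `HasLocating`, the
-- form in which different palms are compared.
Chromatic : (n : ℕ) → (Fin n → ℕ) → Set
Chromatic n a =
  ∃[ χ ] (IsLocChromNum (Palm n a) χ × HasLocating n a χ × (∀ k → HasLocating n a k → χ ≤ k))

chromNum : HasLocating n a k → Chromatic n a
chromNum {n} {a} {k} has with least (hasLocating? a) k has
... | χ , _ , hasχ , min =
  χ , ((proj₁ hasχ , locating⇒isLocatingColoring _ (proj₂ hasχ)) ,
    λ k' lt (c , l) → min k' lt (c , isLocatingColoring⇒locating c l)) ,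
  hasχ , λ k' has' → ≮⇒≥ (λ lt → min k' lt has')

-- Legs, depths and alternating sequences

1+m≤m+n : ∀ m {n} → 1 ≤ n → suc m ≤ m + n
1+m≤m+n m 1≤n = ≤-trans (≤-reflexive (sym (+-comm m 1))) (+-monoʳ-≤ m 1≤n)

leg : PalmV n a → Maybe (Fin n)
leg nothing        = nothing
leg (just (i , _)) = just i

onLeg? : ∀ i (v : PalmV n a) → Dec (leg v ≡ just i)
onLeg? i v = ≡-dec _≟ᶠ_ (leg v) (just i)

leg⇒depth>0 : ∀ {i} {v : PalmV n a} → leg v ≡ just i → 1 ≤ depth v
leg⇒depth>0 {v = just _} _ = s≤s z≤n

-- Paths between different legs pass through the hub. As the hub has leg `nothing`, paths ending
-- there are covered too.
dist-apart : {u v : PalmV n a} → leg u ≢ leg v → dist u v ≡ depth u + depth v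
dist-apart {u = nothing}      {v}            _  = refl
dist-apart {u = just (i , j)} {nothing}      _  = sym (+-identityʳ _)
dist-apart {a = a} {u = just (i , j)} {just (i' , j')} ne = dist-diffLeg a j j' (ne ∘ cong just)

first : ∀ (a : Fin n → ℕ) i → 1 ≤ a i → PalmV n a
first a i 1≤a = just (i , fromℕ< 1≤a)

depth-first : ∀ (a : Fin n → ℕ) i (1≤a : 1 ≤ a i) → depth (first a i 1≤a) ≡ 1
depth-first a i 1≤a = cong suc (toℕ-fromℕ< 1≤a)

-- The first vertex of a leg avoiding u is a probe: it turns domination into a bound by
-- `suc (depth u)`.
dist-first : ∀ (a : Fin n → ℕ) u i (1≤a : 1 ≤ a i) → leg u ≢ just i →
             dist u (first a i 1≤a) ≡ suc (depth u)
dist-first a u i 1≤a off = trans (dist-apart {u = u} off)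
  (trans (cong (depth u +_) (depth-first a i 1≤a)) (+-comm (depth u) 1))

leg-depth-injective : (u v : PalmV n a) → leg u ≡ leg v → depth u ≡ depth v → u ≡ v
leg-depth-injective nothing        nothing         _    _ = refl
leg-depth-injective (just (i , _)) (just (.i , _)) refl e =
  cong (λ x → just (i , x)) (toℕ-injective (suc-injective e))

alt : ℕ → K → K → K
alt zero    x y = x
alt (suc j) x y = alt j y x

alt-either : ∀ j (x y : K) → alt j x y ≡ x ⊎ alt j x y ≡ y
alt-either zero    x y = inj₁ refl
alt-either (suc j) x y = swap (alt-either j y x)

alt-swap-≢ : ∀ j {x y : K} → x ≢ y → alt j x y ≢ alt j y x
alt-swap-≢ zero    x≢y = x≢y
alt-swap-≢ (suc j) x≢y = alt-swap-≢ j (x≢y ∘ sym)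

-- The even positions carry x, and j or its predecessor is even. Looking only backward stays on the
-- leg even at its end.
alt-near : ∀ j (x y : K) → ∃[ j' ] (j' ≤ j × ∣ j - j' ∣ ≤ 1 × alt j' x y ≡ x)
alt-near zero          x y = 0 , z≤n , z≤n , refl
alt-near (suc zero)    x y = 0 , z≤n , ≤-refl , refl
alt-near (suc (suc j)) x y with alt-near j x y
... | j' , le , near , eq = suc (suc j') , s≤s (s≤s le) , near , eq

-- The (n+1)-coloring giving the upper bound

module _ {n} (a : Fin n → ℕ) where

  altColoring : PalmV n a → Maybe (Fin n)
  altColoring nothing        = nothing
  altColoring (just (i , j)) = alt (toℕ j) (just i) nothing

  altColoring-leg : ∀ {w i} → altColoring w ≡ just i → leg w ≡ just i
  altColoring-leg {just (i' , j)} eq with alt-either (toℕ j) (just i') nothing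
  ... | inj₁ e = trans (sym e) eq
  ... | inj₂ e with () ← trans (sym e) eq

  private
    far : ∀ v {w i} → leg v ≢ just i → altColoring w ≡ just i → suc (depth v) ≤ dist v w
    far v {w} off col = ≤-trans (1+m≤m+n (depth v) (leg⇒depth>0 (altColoring-leg col)))
        (≤-reflexive (sym (dist-apart {u = v} {w} λ e → off (trans e (altColoring-leg col)))))

  -- The color of a leg occurs on that leg alone. Hence the distance to the color of a leg avoiding
  -- a vertex reveals the depth of the vertex, and color i is within 1 of every vertex of leg i but
  -- at least 2 away from the vertices of other legs.
  altColoring-locating : (∀ i → 1 ≤ a i) → (∀ (i : Fin n) → ∃[ i' ] i ≢ i') → Locating altColoring
  altColoring-locating pos other = (hubLeg , legLeg) , loc
    where
    hubLeg : ∀ i (j : Fin (a i)) → toℕ j ≡ 0 → nothing ≢ altColoring (just (i , j))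
    hubLeg i j eq rewrite eq = λ ()
    legLeg : ∀ i (j j' : Fin (a i)) → toℕ j' ≡ suc (toℕ j) →
             altColoring (just (i , j)) ≢ altColoring (just (i , j'))
    legLeg i j j' eq rewrite eq = alt-swap-≢ (toℕ j) λ ()
    shorter : ∀ {u v i i'} → leg u ≢ just i' → leg v ≡ just i → i ≢ i' → Dominates altColoring u v →
              depth v ≤ depth u
    shorter {u} {v} {i} {i'} offu onv ne u≥v with u≥v (first a i' (pos i'))
    ... | w' , col , d = s≤s⁻¹ (≤-trans (far v {w'} (λ e → ne (just-injective (trans (sym onv) e)))
            (trans col first-col)) (≤-trans d (≤-reflexive (dist-first a u i' (pos i') offu))))
      where
      first-col : altColoring (first a i' (pos i')) ≡ just i'
      first-col rewrite toℕ-fromℕ< (pos i') = refl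
    apart : ∀ {i i'} {j : Fin (a i)} {j' : Fin (a i')} → i ≢ i' →
            ¬ Dominates altColoring (just (i , j)) (just (i' , j'))
    apart {i} {i'} {j} {j'} ne u≥v with alt-near (toℕ j) (just i) nothing
    ... | m , m≤j , near , eq with u≥v (just (i , fromℕ< (≤-<-trans m≤j (toℕ<n j))))
    ...   | w' , col , d = <⇒≱ (far (just (i' , j')) {w'} (λ e → ne (sym (just-injective e)))
              (trans col (trans (cong (λ x → alt x (just i) nothing) toℕ-m) eq)))
              (≤-trans d (≤-trans (≤-reflexive (trans (dist-sameLeg a i j _)
                (cong (λ x → ∣ toℕ j - x ∣) toℕ-m))) (≤-trans near (s≤s z≤n))))
      where
      toℕ-m : toℕ (fromℕ< (≤-<-trans m≤j (toℕ<n j))) ≡ m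
      toℕ-m = toℕ-fromℕ< _
    loc : ∀ u v → Dominates altColoring u v → Dominates altColoring v u → u ≡ v
    loc nothing nothing _ _ = refl
    loc nothing (just (i , j)) u≥v _ with other i
    ... | i' , ne with () ← shorter {nothing} {just (i , j)} (λ ()) refl ne u≥v
    loc (just (i , j)) nothing _ v≥u with other i
    ... | i' , ne with () ← shorter {nothing} {just (i , j)} (λ ()) refl ne v≥u
    loc (just (i , j)) (just (i' , j')) u≥v v≥u with i ≟ᶠ i'
    ... | no ne = contradiction u≥v (apart {j = j} {j'} ne)
    ... | yes refl with other i
    ...   | i″ , ne = leg-depth-injective _ _ refl (≤-antisym
              (shorter {just (i , j')} {just (i , j)} (ne ∘ just-injective) refl ne v≥u)
              (shorter {just (i , j)} {just (i , j')} (ne ∘ just-injective) refl ne u≥v))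

maybeToFin : Maybe (Fin k) → Fin (suc k)
maybeToFin nothing  = zero
maybeToFin (just x) = suc x

maybeToFin-injective : {x y : Maybe (Fin k)} → maybeToFin x ≡ maybeToFin y → x ≡ y
maybeToFin-injective {x = nothing} {nothing} _  = refl
maybeToFin-injective {x = just x}  {just y}  eq = cong just (sucᶠ-injective eq)

otherLeg : ∀ {m} (i : Fin (suc (suc m))) → ∃[ i' ] i ≢ i'
otherLeg zero    = suc zero , λ ()
otherLeg (suc i) = zero , λ ()

hasLocating-n+1 : ∀ {m} (a : Fin (suc (suc m)) → ℕ) → (∀ i → 1 ≤ a i) →
                  HasLocating (suc (suc m)) a (suc (suc (suc m)))
hasLocating-n+1 a pos =
  maybeToFin ∘ altColoring a , locating-reflect maybeToFin-injective (altColoring-locating a pos otherLeg)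

-- Two leaves of the same color have equal codes, since all other vertices are equally far from
-- both. So the leaves have distinct colors, all different from that of the hub.
star-chromatic : (∀ i → a i ≡ 1) → HasLocating n a k → suc n ≤ k
star-chromatic {n} {a} {k} one (c , (p₁ , _) , loc) = injective⇒≤ {f = f} f-injective
  where
  pos : ∀ i → 1 ≤ a i
  pos i = ≤-reflexive (sym (one i))
  leaf : Fin n → PalmV n a
  leaf i = first a i (pos i)
  j≡0 : ∀ {i} (j : Fin (a i)) → toℕ j ≡ 0
  j≡0 {i} j = n<1⇒n≡0 (subst (toℕ j <_) (one i) (toℕ<n j))
  f : Fin (suc n) → Fin k
  f zero    = c nothing
  f (suc i) = c (leaf i)
  leaf-dom : ∀ {i i'} → c (leaf i) ≡ c (leaf i') → Dominates c (leaf i) (leaf i')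
  leaf-dom {i} {i'} eq nothing = nothing , refl , ≤-reflexive
    (trans (depth-first a i' (pos i')) (sym (depth-first a i (pos i))))
  leaf-dom {i} {i'} eq (just (x , j)) with i ≟ᶠ x
  ... | yes refl = leaf i' , trans (sym eq) (cong (λ y → c (just (i , y)))
          (toℕ-injective (trans (toℕ-fromℕ< (pos i)) (sym (j≡0 j))))) ,
          ≤-trans (≤-reflexive (dist-refl (leaf i'))) z≤n
  ... | no i≢x = just (x , j) , refl , ≤-trans (dist≤depth+depth (leaf i') (just (x , j)))
          (≤-reflexive (cong (_+ suc (toℕ j))
            (trans (depth-first a i' (pos i')) (sym (depth-first a i (pos i))))))
  f-injective : ∀ {x y} → f x ≡ f y → x ≡ y
  f-injective {zero}  {zero}  _  = refl
  f-injective {zero}  {suc i} eq = contradiction eq (p₁ i _ (toℕ-fromℕ< (pos i)))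
  f-injective {suc i} {zero}  eq = contradiction (sym eq) (p₁ i _ (toℕ-fromℕ< (pos i)))
  f-injective {suc i} {suc i'} eq =
    cong suc (just-injective (cong leg (loc (leaf i) (leaf i') (leaf-dom eq) (leaf-dom (sym eq)))))

-- Changing the length of one leg

module OffLeg {n} {i₀ : Fin n} where

  Agree : (a a' : Fin n → ℕ) → Set
  Agree a a' = ∀ i → i ≢ i₀ → a i ≡ a' i

  -- Identifies the parts of the two palms away from leg `i₀`; the lengths there agree only
  -- propositionally, hence `cast`.
  move : {a a' : Fin n → ℕ} → Agree a a' → (v : PalmV n a) → leg v ≢ just i₀ → PalmV n a'
  move same nothing        off = nothing
  move same (just (i , j)) off = just (i , cast (same i (off ∘ cong just)) j)

  leg-move : ∀ {a a'} (same : Agree a a') v off → leg (move same v off) ≡ leg v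
  leg-move same nothing  off = refl
  leg-move same (just _) off = refl

  depth-move : ∀ {a a'} (same : Agree a a') v off → depth (move same v off) ≡ depth v
  depth-move same nothing        off = refl
  depth-move same (just (i , j)) off = cong suc (toℕ-cast _ j)

  dist-move : ∀ {a a'} (same : Agree a a') u v offu offv →
              dist (move same u offu) (move same v offv) ≡ dist u v
  dist-move same nothing        v              offu offv = depth-move same v offv
  dist-move same (just (i , j)) nothing        offu offv = cong suc (toℕ-cast _ j)
  dist-move same (just (i , j)) (just (i' , j')) offu offv with i ≟ᶠ i'
  ... | yes refl = cong₂ ∣_-_∣ (toℕ-cast _ j) (toℕ-cast _ j')
  ... | no _     = cong₂ (λ x y → suc x + suc y) (toℕ-cast _ j) (toℕ-cast _ j')

  move-move : ∀ {a a'} (same : Agree a a') (same' : Agree a' a) v off off' →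
              move same' (move same v off) off' ≡ v
  move-move same same' nothing        off off' = refl
  move-move same same' (just (i , j)) off off' =
    cong (λ x → just (i , x)) (toℕ-injective (trans (toℕ-cast (same' i (off ∘ cong just))
            (cast (same i (off ∘ cong just)) j))
      (toℕ-cast (same i (off ∘ cong just)) j)))

module _ {n k} {a a' : Fin n → ℕ} {i₀ ℓ : Fin n} (ℓ≢i₀ : ℓ ≢ i₀) (pos₀ : 1 ≤ a' i₀) (posℓ : 1 ≤ a' ℓ)
         (same : ∀ i → i ≢ i₀ → a i ≡ a' i) {c : PalmV n a → Fin k} (c-loc : Locating c) where

  open OffLeg {n} {i₀}

  private
    h : Fin k
    h = c nothing

    same' : Agree a' a
    same' i ne = sym (same i ne)

    Off : PalmV n a' → Set
    Off v = leg v ≢ just i₀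

    φ : (v : PalmV n a') → Off v → PalmV n a
    φ = move same'

  -- The new color is `nothing`. Counting by depth, with the hub color at depth 0, puts the new
  -- color on the first vertex of leg `i₀`.
  recolor : PalmV n a' → Maybe (Fin k)
  recolor v with onLeg? i₀ v
  ... | yes _  = alt (depth v) (just h) nothing
  ... | no off = just (c (φ v off))

  private
    recolor-on : ∀ v → leg v ≡ just i₀ → recolor v ≡ alt (depth v) (just h) nothing
    recolor-on v on with onLeg? i₀ v
    ... | yes _  = refl
    ... | no off = contradiction on off

    recolor-off : ∀ v off → recolor v ≡ just (c (φ v off))
    recolor-off v off with onLeg? i₀ v
    ... | yes on = contradiction on off
    ... | no off' = cong (just ∘ c) (φ-irr v)
      where
      φ-irr : ∀ v {off off'} → φ v off ≡ φ v off'
      φ-irr nothing  = refl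
      φ-irr (just _) = refl

    new⇒on : ∀ {w} → recolor w ≡ nothing → leg w ≡ just i₀
    new⇒on {w} eq with onLeg? i₀ w
    ... | yes on = on
    new⇒on {w} () | no _

    other⇒off : ∀ {w y} → y ≢ h → recolor w ≡ just y → Off w × 1 ≤ depth w
    other⇒off {w} y≢h eq with onLeg? i₀ w
    ... | yes _ with alt-either (depth w) (just h) nothing
    ...   | inj₁ e = contradiction (just-injective (trans (sym eq) e)) y≢h
    ...   | inj₂ e with () ← trans (sym e) eq
    other⇒off {nothing} y≢h eq | no off = contradiction (sym (just-injective eq)) y≢h
    other⇒off {just _}  y≢h eq | no off = off , s≤s z≤n

    fst₀ fstℓ : PalmV n a'
    fst₀ = first a' i₀ pos₀
    fstℓ = first a' ℓ posℓ

    offℓ : Off fstℓ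
    offℓ = ℓ≢i₀ ∘ just-injective

    -- A color that is neither new nor the hub color, so its class avoids both leg `i₀` and the hub.
    y : Fin k
    y = c (φ fstℓ offℓ)

    y≢h : y ≢ h
    y≢h = proj₁ (proj₁ c-loc) ℓ _ (trans (toℕ-cast _ _) (toℕ-fromℕ< posℓ)) ∘ sym

    recolor-fst₀ : recolor fst₀ ≡ nothing
    recolor-fst₀ = trans (recolor-on fst₀ refl)
      (cong (λ d → alt d (just h) nothing) (depth-first a' i₀ pos₀))

    off≢on : ∀ {u v : PalmV n a'} → Off u → leg v ≡ just i₀ → leg u ≢ leg v
    off≢on offu onv e = offu (trans e onv)

    -- The new color lives on leg `i₀` and starts at depth 1, so a vertex off that leg sees it at
    -- distance exactly its depth plus 1.
    offDepth : ∀ u v → Off u → Off v → Dominates recolor u v → depth v ≤ depth u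
    offDepth u v offu offv u≥v with u≥v fst₀
    ... | w' , col , d = s≤s⁻¹ (≤-trans (1+m≤m+n (depth v) (leg⇒depth>0 on))
            (≤-trans (≤-reflexive (sym (dist-apart (off≢on {v} {w'} offv on))))
              (≤-trans d (≤-reflexive (dist-first a' u i₀ pos₀ offu)))))
      where on = new⇒on (trans col recolor-fst₀)

    -- From v the class of `y` lies beyond the hub, at distance at least `suc (depth v)`; from u it
    -- is at most `suc (depth u)` away, at the start of leg ℓ.
    onDepth : ∀ u v → leg v ≡ just i₀ → leg u ≢ just ℓ →
              Dominates recolor u v → depth v ≤ depth u
    onDepth u v onv offu u≥v with u≥v fstℓ
    ... | w' , col , d with other⇒off {w'} y≢h (trans col (recolor-off fstℓ offℓ))
    ...   | off , 1≤d = s≤s⁻¹ (≤-trans (1+m≤m+n (depth v) 1≤d)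
            (≤-trans (≤-reflexive (sym (dist-apart (off≢on {w'} {v} off onv ∘ sym))))
              (≤-trans d (≤-reflexive (dist-first a' u ℓ posℓ offu)))))

    -- For u and v of equal depth, a color class inside leg i₀ contributes the same distance to both codes,
    -- so it never separates them and can be discarded.
    lower : ∀ u v offu offv → depth u ≡ depth v → Dominates recolor u v → Dominates c (φ u offu) (φ v offv)
    lower u v offu offv deq u≥v w with onLeg? i₀ w
    ... | yes on = w , refl , ≤-reflexive (trans (far v offv) (trans (cong (_+ depth w) (sym deq))
            (sym (far u offu))))
      where
      far : ∀ v off → dist (φ v off) w ≡ depth v + depth w
      far v off = trans (dist-apart λ e → off (trans (sym (leg-move same' v off)) (trans e on)))
                        (cong (_+ depth w) (depth-move same' v off))
    ... | no off = result
      where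
      off' : Off (move same w off)
      off' e = off (trans (sym (leg-move same w off)) e)
      col-w : recolor (move same w off) ≡ just (c w)
      col-w = trans (recolor-off _ off') (cong (just ∘ c) (move-move same same' w off off'))
      dist-w : dist u (move same w off) ≡ dist (φ u offu) w
      dist-w = trans (sym (dist-move same' u _ offu off')) (cong (dist (φ u offu))
              (move-move same same' w off off'))
      result : ∃[ w' ] (c w' ≡ c w × dist (φ v offv) w' ≤ dist (φ u offu) w)
      result with u≥v (move same w off)
      ... | w' , col , d with onLeg? i₀ w'
      ...   | no off″ = φ w' off″ , just-injective (trans col col-w) ,
                ≤-trans (≤-reflexive (dist-move same' v w' offv off″)) (≤-trans d (≤-reflexive dist-w))
      -- On leg `i₀` an old color can only be the hub color, and the hub is nearer to v than w' is.
      ...   | yes on″ = nothing , h≡ (alt-either (depth w') (just h) nothing) ,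
                ≤-trans (≤-reflexive (trans (dist-hubʳ _) (depth-move same' v offv)))
                  (≤-trans (m≤m+n (depth v) (depth w'))
                    (≤-trans (≤-reflexive (sym (dist-apart (off≢on {v} {w'} offv on″))))
                      (≤-trans d (≤-reflexive dist-w))))
        where
        h≡ : alt (depth w') (just h) nothing ≡ just h ⊎ alt (depth w') (just h) nothing ≡ nothing → h ≡ c w
        h≡ (inj₁ e) = just-injective (trans (sym e) (trans col col-w))
        h≡ (inj₂ e) with () ← trans (sym e) (trans col col-w)

    -- If u is the hub, `onDepth` is violated. Otherwise the new color is within 1 of v, at v or its
    -- predecessor, while u has depth at least 1 and is at least 2 away from it.
    offon : ∀ u v → Off u → leg v ≡ just i₀ → Dominates recolor u v → ¬ Dominates recolor v u
    offon nothing v offu onv u≥v _ = <⇒≱ (leg⇒depth>0 onv) (onDepth nothing v onv (λ ()) u≥v)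
    offon u@(just (_ , x)) v@(just (.i₀ , j)) offu refl _ v≥u with alt-near (toℕ j) nothing (just h)
    ... | m , m≤j , near , eq with v≥u (just (i₀ , fromℕ< (≤-<-trans m≤j (toℕ<n j))))
    ...   | w' , col , d = <⇒≱ {1} {2} ≤-refl (≤-trans (≤-trans (+-mono-≤ (s≤s (z≤n {toℕ x}))
            (leg⇒depth>0 on))
              (≤-reflexive (sym (dist-apart (off≢on {u} {w'} offu on)))))
              (≤-trans d (≤-trans (≤-reflexive (trans (dist-sameLeg a' i₀ j _)
                (cong (λ x → ∣ toℕ j - x ∣) toℕ-m))) near)))
      where
      toℕ-m : toℕ (fromℕ< (≤-<-trans m≤j (toℕ<n j))) ≡ m
      toℕ-m = toℕ-fromℕ< _
      on : leg w' ≡ just i₀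
      on = new⇒on (trans col (trans (recolor-on (just (i₀ , _)) refl)
             (trans (cong (λ x → alt x nothing (just h)) toℕ-m) eq)))

  -- Off leg `i₀`, the new color yields equal depths and `lower` then returns to `c`; on leg `i₀`
  -- depth alone decides; `offon` excludes the mixed case.
  recolor-locating : Locating recolor
  recolor-locating = (hubLeg , legLeg) , loc
    where
    hubLeg : ∀ i (j : Fin (a' i)) → toℕ j ≡ 0 → recolor nothing ≢ recolor (just (i , j))
    hubLeg i j eq e with onLeg? {a = a'} i₀ (just (i , j))
    ... | no off = proj₁ (proj₁ c-loc) i _ (trans
            (toℕ-cast (same' i (off ∘ cong just)) j) eq) (just-injective e)
    ... | yes _ rewrite eq with () ← e
    legLeg : ∀ i (j j' : Fin (a' i)) → toℕ j' ≡ suc (toℕ j) → recolor (just (i , j)) ≢ recolor (just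
            (i , j'))
    legLeg i j j' eq e = case i ≟ᶠ i₀ of λ where
      (yes refl) → alt-swap-≢ (suc (toℕ j)) {just h} {nothing} (λ ())
            (trans (sym (recolor-on (just (i , j)) refl)) (trans e
              (trans (recolor-on (just (i , j')) refl) (cong (λ x → alt (suc x) (just h) nothing) eq))))
      (no ne) → proj₂ (proj₁ c-loc) i _ _ (trans (toℕ-cast _ j') (trans eq (cong suc (sym (toℕ-cast _ j)))))
            (just-injective (trans (sym (recolor-off (just (i , j)) (ne ∘ just-injective)))
              (trans e (recolor-off (just (i , j')) (ne ∘ just-injective)))))
    loc : ∀ u v → Dominates recolor u v → Dominates recolor v u → u ≡ v
    loc u v u≥v v≥u with onLeg? i₀ u | onLeg? i₀ v
    ... | no offu | no offv = dist≡0⇒≡ (trans (sym (dist-move same' u v offu offv))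
            (trans (cong (dist (φ u offu)) (sym eq)) (dist-refl (φ u offu))))
      where
      deq : depth u ≡ depth v
      deq = ≤-antisym (offDepth v u offv offu v≥u) (offDepth u v offu offv u≥v)
      eq : φ u offu ≡ φ v offv
      eq = proj₂ c-loc _ _ (lower u v offu offv deq u≥v) (lower v u offv offu (sym deq) v≥u)
    ... | no offu | yes onv = contradiction v≥u (offon u v offu onv u≥v)
    ... | yes onu | no offv = contradiction u≥v (offon v u offv onu v≥u)
    ... | yes onu | yes onv = leg-depth-injective u v (trans onu (sym onv))
            (≤-antisym (onDepth v u onu (notℓ v onv) v≥u) (onDepth u v onv (notℓ u onu) u≥v))
      where
      notℓ : ∀ v → leg v ≡ just i₀ → leg v ≢ just ℓ
      notℓ v on e = ℓ≢i₀ (just-injective (trans (sym e) on))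

-- The lower bound

length-cartesianProductWith : {A B C : Set} (f : A → B → C) (xs : List A) (ys : List B) →
                              length (cartesianProductWith f xs ys) ≡ length xs * length ys
length-cartesianProductWith f []       ys = refl
length-cartesianProductWith f (x ∷ xs) ys = trans (length-++ (map (f x) ys))
  (cong₂ _+_ (length-map (f x) ys) (length-cartesianProductWith f xs ys))

-- Counting ternary words with one zero among marked positions

digits nonzero : List (Fin 3)
digits  = 0F ∷ 1F ∷ 2F ∷ []
nonzero = 1F ∷ 2F ∷ []

noZeros : (Fin m → Bool) → List (Vec (Fin 3) m)
noZeros {zero}  S = [] ∷ []
noZeros {suc m} S = cartesianProductWith _∷_ (if S zero then nonzero else digits) (noZeros (S ∘ suc))

-- Letters 0, 1, 2 will stand for a change of a coordinate by -1, 0, 1 from the hub to a neighbor,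
-- and `S` for the colors at distance 1 from the hub: of these, only the neighbor's own color gets
-- closer.
oneZero : (Fin m → Bool) → List (Vec (Fin 3) m)
oneZero {zero}  S = []
oneZero {suc m} S = if S zero
  then cartesianProductWith _∷_ (0F ∷ []) (noZeros (S ∘ suc)) ++
       cartesianProductWith _∷_ nonzero (oneZero (S ∘ suc))
  else cartesianProductWith _∷_ digits (oneZero (S ∘ suc))

∈-digits : ∀ d → d ∈ digits
∈-digits 0F = here refl
∈-digits 1F = there (here refl)
∈-digits 2F = there (there (here refl))

∈-nonzero : ∀ {d} → d ≢ 0F → d ∈ nonzero
∈-nonzero {0F} d≢0 = contradiction refl d≢0
∈-nonzero {1F} _   = here refl
∈-nonzero {2F} _   = there (here refl)

∈-noZeros : ∀ {S : Fin m → Bool} {d : Fin m → Fin 3} →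
            (∀ x → S x ≡ true → d x ≢ 0F) → tabulate d ∈ noZeros S
∈-noZeros {zero}      _  = here refl
∈-noZeros {suc m} {S} {d} ok = ∈-cartesianProductWith⁺ _∷_ head (∈-noZeros (ok ∘ suc))
  where
  head : d zero ∈ (if S zero then nonzero else digits)
  head with S zero in eq
  ... | true  = ∈-nonzero (ok zero eq)
  ... | false = ∈-digits _

∈-oneZero : ∀ {S : Fin m → Bool} {d : Fin m → Fin 3} y → S y ≡ true → d y ≡ 0F →
            (∀ x → x ≢ y → S x ≡ true → d x ≢ 0F) → tabulate d ∈ oneZero S
∈-oneZero {suc m} {S} {d} zero Sy dy ok rewrite Sy | dy =
  ∈-++⁺ˡ {xs = cartesianProductWith _∷_ (0F ∷ []) (noZeros (S ∘ suc))}
    (∈-cartesianProductWith⁺ _∷_ {xs = 0F ∷ []} (here refl) (∈-noZeros λ x → ok (suc x) λ ()))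
∈-oneZero {suc m} {S} {d} (suc y) Sy dy ok with S zero in eq
... | true  = ∈-++⁺ʳ (cartesianProductWith _∷_ (0F ∷ []) (noZeros (S ∘ suc)))
                (∈-cartesianProductWith⁺ _∷_ (∈-nonzero (ok zero (λ ()) eq)) rest)
  where rest = ∈-oneZero y Sy dy λ x ne → ok (suc x) (ne ∘ sucᶠ-injective)
... | false = ∈-cartesianProductWith⁺ _∷_ (∈-digits _) rest
  where rest = ∈-oneZero y Sy dy λ x ne → ok (suc x) (ne ∘ sucᶠ-injective)

trues falses : (Fin m → Bool) → ℕ
trues {zero}  S = 0
trues {suc m} S = if S zero then suc (trues (S ∘ suc)) else trues (S ∘ suc)
falses {zero}  S = 0
falses {suc m} S = if S zero then falses (S ∘ suc) else suc (falses (S ∘ suc))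

trues+falses : (S : Fin m → Bool) → trues S + falses S ≡ m
trues+falses {zero}  S = refl
trues+falses {suc m} S with S zero
... | true  = cong suc (trues+falses (S ∘ suc))
... | false = trans (+-suc _ _) (cong suc (trues+falses (S ∘ suc)))

length-noZeros : (S : Fin m → Bool) → length (noZeros S) ≡ 2 ^ trues S * 3 ^ falses S
length-noZeros {zero}  S = refl
length-noZeros {suc m} S with S zero
... | true  = trans (length-cartesianProductWith _∷_ nonzero (noZeros (S ∘ suc)))
                (trans (cong (2 *_) (length-noZeros (S ∘ suc))) (sym (*-assoc 2 (2 ^ trues (S ∘ suc)) _)))
... | false = trans (length-cartesianProductWith _∷_ digits (noZeros (S ∘ suc)))
                (trans (cong (3 *_) (length-noZeros (S ∘ suc))) (lemma (2 ^ trues (S ∘ suc)) _))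
  where
  lemma : ∀ p q → 3 * (p * q) ≡ p * (3 * q)
  lemma = solve-∀

-- Placing the zero gives s·2^(s-1)·3^r words, with s marked and r unmarked positions; doubling
-- avoids the exponent s-1.
2*length-oneZero : (S : Fin m → Bool) →
                   2 * length (oneZero S) ≡ trues S * (2 ^ trues S * 3 ^ falses S)
2*length-oneZero {zero}  S = refl
2*length-oneZero {suc m} S with S zero
... | true  = begin
    2 * length (A ++ B)                 ≡⟨ cong (2 *_) (length-++ A) ⟩
    2 * (length A + length B)           ≡⟨ cong₂ (λ x y → 2 * (x + y))
                                            (length-cartesianProductWith _∷_ (0F ∷ []) (noZeros S'))
                                            (length-cartesianProductWith _∷_ nonzero (oneZero S')) ⟩
    2 * (1 * length (noZeros S') + 2 * length (oneZero S'))
                                        ≡⟨ cong₂ (λ x y → 2 * (1 * x + y)) (length-noZeros S') (2*length-oneZero S') ⟩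
    2 * (1 * (p * q) + s * (p * q))     ≡⟨ lemma s p q ⟩
    suc s * (2 * p * q)                 ∎
  where
  open ≡-Reasoning
  S' = S ∘ suc
  A  = cartesianProductWith Vec._∷_ (0F ∷ []) (noZeros S')
  B  = cartesianProductWith Vec._∷_ nonzero (oneZero S')
  s  = trues S'
  p  = 2 ^ trues S'
  q  = 3 ^ falses S'
  lemma : ∀ s p q → 2 * (1 * (p * q) + s * (p * q)) ≡ suc s * (2 * p * q)
  lemma = solve-∀
... | false = begin
    2 * length (cartesianProductWith Vec._∷_ digits (oneZero S'))
                                ≡⟨ cong (2 *_) (length-cartesianProductWith _∷_ digits (oneZero S')) ⟩
    2 * (3 * length (oneZero S')) ≡⟨ swap₂₃ (length (oneZero S')) ⟩
    3 * (2 * length (oneZero S')) ≡⟨ cong (3 *_) (2*length-oneZero S') ⟩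
    3 * (s * (p * q))           ≡⟨ lemma s p q ⟩
    s * (p * (3 * q))           ∎
  where
  open ≡-Reasoning
  S' = S ∘ suc
  s  = trues S'
  p  = 2 ^ trues S'
  q  = 3 ^ falses S'
  swap₂₃ : ∀ x → 2 * (3 * x) ≡ 3 * (2 * x)
  swap₂₃ = solve-∀
  lemma : ∀ s p q → 3 * (s * (p * q)) ≡ s * (p * (3 * q))
  lemma = solve-∀

-- The value s·(2/3)^s peaks at s = 2 and s = 3 with 8/9: from s = 2 on, consecutive terms have
-- ratio 2(s+1)/(3s) ≤ 1.
9s2^s≤8*3^s : ∀ s → 9 * (s * 2 ^ s) ≤ 8 * 3 ^ s
9s2^s≤8*3^s 0 = z≤n
9s2^s≤8*3^s 1 = ≤ᵇ⇒≤ 18 24 _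
9s2^s≤8*3^s 2 = ≤-refl
9s2^s≤8*3^s (suc s@(suc (suc r))) = begin
  -- With s = r + 2 the added term is exactly the difference 27s·2^s - 18(s+1)·2^s.
  9 * (suc s * (2 * 2 ^ s))   ≤⟨ ≤-trans (m≤m+n _ (9 * (r * 2 ^ s))) (≤-reflexive (eq r (2 ^ s))) ⟩
  3 * (9 * (s * 2 ^ s))       ≤⟨ *-monoʳ-≤ 3 (9s2^s≤8*3^s s) ⟩
  3 * (8 * 3 ^ s)             ≡⟨ eq' (3 ^ s) ⟩
  8 * (3 * 3 ^ s)             ∎
  where
  open ≤-Reasoning
  eq : ∀ r p → 9 * (suc (suc (suc r)) * (2 * p)) + 9 * (r * p) ≡ 3 * (9 * (suc (suc r) * p))
  eq = solve-∀
  eq' : ∀ p → 3 * (8 * p) ≡ 8 * (3 * p)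
  eq' = solve-∀

9*length-oneZero : (S : Fin m → Bool) → 9 * length (oneZero S) ≤ 4 * 3 ^ m
9*length-oneZero {m} S = *-cancelˡ-≤ 2 (begin
  2 * (9 * length (oneZero S))  ≡⟨ swap₂₉ (length (oneZero S)) ⟩
  9 * (2 * length (oneZero S))  ≡⟨ cong (9 *_) (2*length-oneZero S) ⟩
  9 * (s * (2 ^ s * 3 ^ r))     ≡⟨ assoc s (2 ^ s) (3 ^ r) ⟩
  9 * (s * 2 ^ s) * 3 ^ r       ≤⟨ *-monoˡ-≤ (3 ^ r) (9s2^s≤8*3^s s) ⟩
  8 * 3 ^ s * 3 ^ r             ≡⟨ assoc' (3 ^ s) (3 ^ r) ⟩
  2 * (4 * (3 ^ s * 3 ^ r))     ≡⟨ cong (λ x → 2 * (4 * x)) (sym (^-distribˡ-+-* 3 s r)) ⟩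
  2 * (4 * 3 ^ (s + r))         ≡⟨ cong (λ x → 2 * (4 * 3 ^ x)) (trues+falses S) ⟩
  2 * (4 * 3 ^ m)               ∎)
  where
  open ≤-Reasoning
  s = trues S
  r = falses S
  swap₂₉ : ∀ x → 2 * (9 * x) ≡ 9 * (2 * x)
  swap₂₉ = solve-∀
  assoc : ∀ s p q → 9 * (s * (p * q)) ≡ 9 * (s * p) * q
  assoc = solve-∀
  assoc' : ∀ p q → 8 * p * q ≡ 2 * (4 * (p * q))
  assoc' = solve-∀

tabulate-injective : {A : Set} {f g : Fin m → A} → tabulate f ≡ tabulate g → ∀ x → f x ≡ g x
tabulate-injective {f = f} {g} eq x =
  trans (sym (lookup∘tabulate f x)) (trans (cong (λ v → Vec.lookup v x) eq) (lookup∘tabulate g x))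

injective-∈⇒≤ : {A : Set} {xs : List A} {f : Fin n → A} →
                (∀ {i j} → f i ≡ f j → i ≡ j) → (∀ i → f i ∈ xs) → n ≤ length xs
injective-∈⇒≤ {xs = xs} {f} inj f∈ = injective⇒≤ {f = λ i → index (f∈ i)} λ {i} {j} eq →
  inj (trans (lookup-index (f∈ i)) (trans (cong (lookup xs) eq) (sym (lookup-index (f∈ j)))))

module _ {A B : Set} where

  digit : Dec A → Dec B → Fin 3
  digit (yes _) _       = 0F
  digit (no _)  (yes _) = 1F
  digit (no _)  (no _)  = 2F

  digit≡0 : ∀ {p : Dec A} {q : Dec B} → digit p q ≡ 0F → A
  digit≡0 {yes x} _ = x
  digit≡0 {no _} {yes _} ()
  digit≡0 {no _} {no _}  ()

  A⇒digit≡0 : ∀ {p : Dec A} {q : Dec B} → A → digit p q ≡ 0F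
  A⇒digit≡0 {yes _} _ = refl
  A⇒digit≡0 {no ¬x} x = contradiction x ¬x

module _ {A A' B B' : Set} where

  digit-≡⇒A : ∀ {p : Dec A} {q : Dec B} {p' : Dec A'} {q' : Dec B'} → digit p q ≡ digit p' q' → A → A'
  digit-≡⇒A {p} {q} eq x = digit≡0 (trans (sym eq) (A⇒digit≡0 {p = p} {q} x))

  -- Read A as strictly closer and B as no farther. Digit 0 does not reveal the second answer, so
  -- there `A' → B'` supplies it.
  digit-≡⇒B : ∀ {p : Dec A} {q : Dec B} {p' : Dec A'} {q' : Dec B'} →
              (A' → B') → digit p q ≡ digit p' q' → B → B'
  digit-≡⇒B {p' = yes x'} A'⇒B' _ _ = A'⇒B' x'
  digit-≡⇒B {q = yes _} {no _} {yes y'} _ _ _ = y'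
  digit-≡⇒B {yes _} {yes _} {no _} {no _} _ () _
  digit-≡⇒B {no _} {yes _} {no _} {no _} _ () _
  digit-≡⇒B {q = no ¬y} {no _} _ _ y = contradiction y ¬y

-- Color codes of the neighbors of the hub

module _ {n m} {a : Fin n → ℕ} (pos : ∀ i → 1 ≤ a i) {c : PalmV n a → Fin
        (suc m)} (c-loc : Locating c) where

  private
    h : Fin (suc m)
    h = c nothing

    v : Fin n → PalmV n a
    v i = first a i (pos i)

    h≢cv : ∀ i → h ≢ c (v i)
    h≢cv i = proj₁ (proj₁ c-loc) i _ (toℕ-fromℕ< (pos i))

    hub-v : ∀ i w → depth w ≤ suc (dist (v i) w) × dist (v i) w ≤ suc (depth w)
    hub-v i = dist-arc (hub-leg i _ (toℕ-fromℕ< (pos i)))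

    Nearest : Fin (suc m) → Set
    Nearest X = ∃[ w ] (c w ≡ X × (∀ w' → c w' ≡ X → depth w ≤ depth w'))

    nearest : ∀ X → Nearest X ⊎ (∀ w → c w ≢ X)
    nearest X with anyV? (λ w → c w ≟ᶠ X)
    ... | no ¬∃ = inj₂ λ w e → ¬∃ (w , e)
    ... | yes (w , e) with least (λ d → anyV? λ w' → (c w' ≟ᶠ X) ×-dec
            (depth w' ≟ d)) (depth w) (w , e , refl)
    ...   | _ , _ , (w₀ , e₀ , refl) , min = inj₁ (w₀ , e₀ , λ w' e' → ≮⇒≥ λ lt → min _ lt (w' , e' , refl))

    -- The code of the hub. The default 0 keeps absent colors out of those at distance 1.
    D : Fin (suc m) → ℕ
    D X with nearest X
    ... | inj₁ (w , _) = depth w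
    ... | inj₂ _       = 0

    D-attained : ∀ w → ∃[ w₀ ] (c w₀ ≡ c w × depth w₀ ≡ D (c w))
    D-attained w with nearest (c w)
    ... | inj₁ (w₀ , e , _) = w₀ , e , refl
    ... | inj₂ none         = contradiction refl (none w)

    D-min : ∀ w → D (c w) ≤ depth w
    D-min w with nearest (c w)
    ... | inj₁ (_ , _ , min) = min w refl
    ... | inj₂ none          = contradiction refl (none w)

    closer? : ∀ i X → Dec (∃[ w ] (c w ≡ X × dist (v i) w < D X))
    closer? i X = anyV? λ w → (c w ≟ᶠ X) ×-dec (dist (v i) w <? D X)

    close? : ∀ i X → Dec (∃[ w ] (c w ≡ X × dist (v i) w ≤ D X))
    close? i X = anyV? λ w → (c w ≟ᶠ X) ×-dec (dist (v i) w ≤? D X)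

    -- the X-coordinate of r_c(v i) minus that of r_c(hub), plus 1
    dig : Fin n → Fin (suc m) → Fin 3
    dig i X = digit (closer? i X) (close? i X)

    -- The hub color is skipped, as its coordinate is 1 for every neighbor of the hub.
    word : Fin n → Fin m → Fin 3
    word i x = dig i (punchIn h x)

    word⇒dig : ∀ {i i'} → (∀ x → word i x ≡ word i' x) → ∀ {X} → h ≢ X → dig i X ≡ dig i' X
    word⇒dig {i} {i'} eq h≢X = subst (λ X → dig i X ≡ dig i' X) (punchIn-punchOut h≢X) (eq (punchOut h≢X))

    -- A coordinate changes by at most 1 along an edge, so the word of a neighbor determines its
    -- code.
    dominates : ∀ {i i'} → (∀ x → word i x ≡ word i' x) → Dominates c (v i) (v i')
    dominates {i} {i'} eq w with h ≟ᶠ c w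
    -- The hub is at distance 1 from `v i'`, and w is not `v i` because it has the hub color.
    ... | yes h≡ = nothing , h≡ , ≤-trans (≤-reflexive (depth-first a i' (pos i'))) (n≢0⇒n>0 λ d≡0 →
            h≢cv i (trans h≡ (cong c (sym (dist≡0⇒≡ {u = v i} {w} d≡0)))))
    ... | no h≢ with dist (v i) w <? D (c w) | dist (v i) w ≤? D (c w)
    ...   | yes lt | _ with digit-≡⇒A {p = closer? i (c w)} {close? i
            (c w)} (word⇒dig {i} {i'} eq h≢) (w , refl , lt)
    ...     | w' , col , lt' = w' , col , s≤s⁻¹ (≤-trans lt' (≤-trans (D-min w) (proj₁ (hub-v i w))))
    dominates {i} {i'} eq w | no h≢ | no nlt | yes le
      with digit-≡⇒B {p = closer? i (c w)} {close? i (c w)} {closer? i' (c w)} {close? i' (c w)}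
             (λ (w' , e , d) → w' , e , <⇒≤ d) (word⇒dig {i} {i'} eq h≢) (w , refl , le)
    ...     | w' , col , le' = w' , col , ≤-trans le' (≮⇒≥ nlt)
    -- Here w is farther than `D` from `v i`; the vertex of its color nearest to the hub is within
    -- `D` + 1 of `v i'`.
    dominates {i} {i'} eq w | no h≢ | no _ | no nle with D-attained w
    ...     | w₀ , col , d≡ = w₀ , col , ≤-trans (proj₂ (hub-v i' w₀)) (≤-trans (s≤s (≤-reflexive d≡))
            (≰⇒> nle))

    word-injective : ∀ {i i'} → tabulate (word i) ≡ tabulate (word i') → i ≡ i'
    word-injective {i} {i'} eq = just-injective (cong leg (proj₂ c-loc (v i) (v i')
      (dominates {i} {i'} (tabulate-injective eq)) (dominates {i'} {i} (tabulate-injective (sym eq)))))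

    S : Fin m → Bool
    S x = D (punchIn h x) ≡ᵇ 1

    D-v : ∀ i → D (c (v i)) ≡ 1
    D-v i = ≤-antisym (≤-trans (D-min (v i)) (≤-reflexive (depth-first a i (pos i)))) (1≤
            (D-attained (v i)))
      where
      1≤ : ∃[ w₀ ] (c w₀ ≡ c (v i) × depth w₀ ≡ D (c (v i))) → 1 ≤ D (c (v i))
      1≤ (nothing , e , _)  = contradiction e (h≢cv i)
      1≤ (just _ , _ , d≡) = subst (1 ≤_) d≡ (s≤s z≤n)

    S⇒D≡1 : ∀ x → S x ≡ true → D (punchIn h x) ≡ 1
    S⇒D≡1 x e = ≡ᵇ⇒≡ _ 1 (subst T (sym e) _)

    word∈ : ∀ i → tabulate (word i) ∈ oneZero S
    word∈ i = ∈-oneZero y (cong (_≡ᵇ 1) (trans (cong D y≡) (D-v i)))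
      (A⇒digit≡0 {p = closer? i _} {close? i _}
        (v i , sym y≡ , subst₂ _<_ (sym (dist-refl (v i))) (sym (trans (cong D y≡) (D-v i))) (s≤s z≤n)))
      only
      where
      y : Fin m
      y = punchOut (h≢cv i)
      y≡ : punchIn h y ≡ c (v i)
      y≡ = punchIn-punchOut (h≢cv i)
      -- A color at distance 1 from the hub that gets closer is at distance 0, hence the color of
      -- `v i` itself.
      only : ∀ x → x ≢ y → S x ≡ true → word i x ≢ 0F
      only x x≢y Sx wx with digit≡0 {p = closer? i _} {close? i _} wx
      ... | w , col , lt = x≢y (punchIn-injective h x y (trans (sym col)
              (trans (cong c (sym (dist≡0⇒≡ {u = v i} {w} (n<1⇒n≡0 (subst (_ <_) (S⇒D≡1 x Sx) lt)))))
                      (sym y≡))))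

  9*legs≤4*3^m : 9 * n ≤ 4 * 3 ^ m
  9*legs≤4*3^m = ≤-trans (*-monoʳ-≤ 9 (injective-∈⇒≤ word-injective word∈)) (9*length-oneZero S)

-- Having k = m+1 < t+3 would give 9n ≤ 4·3^(t+1). For t = s+1 this says n ≤ 4·3^s, against the
-- choice of t; for t = 0 it says 9n ≤ 12, against n ≥ 2.
chromatic-lower : ∀ {t} → 2 ≤ n → (∀ s → s < t → 4 * 3 ^ s < n) → (∀ i → 1 ≤ a i) →
                  HasLocating n a k → t + 3 ≤ k
chromatic-lower {k = zero} _ _ _ (c , _) with () ← c nothing
chromatic-lower {n} {k = suc m} {t} 2≤n large pos (c , c-loc) = ≮⇒≥ λ lt →
  absurd t large (≤-trans (9*legs≤4*3^m pos c-loc) (*-monoʳ-≤ 4 (^-monoʳ-≤ 3 (m≤ lt))))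
  where
  m≤ : suc m < t + 3 → m ≤ suc t
  m≤ lt = s≤s⁻¹ (s≤s⁻¹ (≤-trans lt (≤-reflexive (+-comm t 3))))
  absurd : ∀ t → (∀ s → s < t → 4 * 3 ^ s < n) → ¬ (9 * n ≤ 4 * 3 ^ suc t)
  absurd zero _ le = <⇒≱ (≤-trans (≤ᵇ⇒≤ 13 18 _) (*-monoʳ-≤ 9 2≤n)) le
  absurd (suc s) large le = <⇒≱ (*-monoʳ-< 9 (large s ≤-refl)) (≤-trans le (≤-reflexive (eq (3 ^ s))))
    where
    eq : ∀ p → 4 * (3 * (3 * p)) ≡ 9 * (4 * p)
    eq = solve-∀

-- The extremal coloring

-- From depth p, depth q on the same leg is nearer than depth r on another leg, even if q = r+1.
∣p-q∣<p+r : ∀ p {q r} → 1 ≤ p → 1 ≤ r → q ≤ suc r → ∣ p - q ∣ < p + r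
∣p-q∣<p+r p {q} {r} 1≤p 1≤r q≤ with ≤-total p q
... | inj₁ p≤q = ≤-<-trans (≤-reflexive (m≤n⇒∣m-n∣≡n∸m p≤q))
                   (≤-<-trans (≤-trans (∸-monoʳ-≤ q 1≤p) (∸-monoˡ-≤ 1 q≤)) (m<n+m r 1≤p))
... | inj₂ q≤p = ≤-<-trans (≤-trans (≤-reflexive (m≤n⇒∣n-m∣≡n∸m q≤p)) (m∸n≤m p q)) (m<m+n p 1≤r)

-- The two distances have different parity. So slots at consecutive depths are told apart from every
-- depth p.
∣p-1+q∣≢∣p-q∣ : ∀ p q → ∣ p - suc q ∣ ≢ ∣ p - q ∣
∣p-1+q∣≢∣p-q∣ zero    q       = 1+n≢n
∣p-1+q∣≢∣p-q∣ (suc p) zero    e = 1+n≢n (sym (trans (sym (∣-∣-identityʳ p)) e))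
∣p-1+q∣≢∣p-q∣ (suc p) (suc q) = ∣p-1+q∣≢∣p-q∣ p q

∣p-q∣≤1⇒ : ∀ p q → ∣ p - q ∣ ≤ 1 → q ≡ p ⊎ suc q ≡ p ⊎ q ≡ suc p
∣p-q∣≤1⇒ zero          zero          _ = inj₁ refl
∣p-q∣≤1⇒ zero          (suc zero)    _ = inj₂ (inj₂ refl)
∣p-q∣≤1⇒ zero          (suc (suc q)) (s≤s ())
∣p-q∣≤1⇒ (suc zero)    zero          _ = inj₂ (inj₁ refl)
∣p-q∣≤1⇒ (suc (suc p)) zero          (s≤s ())
∣p-q∣≤1⇒ (suc p)       (suc q)       le with ∣p-q∣≤1⇒ p q le
... | inj₁ e        = inj₁ (cong suc e)
... | inj₂ (inj₁ e) = inj₂ (inj₁ (cong suc e))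
... | inj₂ (inj₂ e) = inj₂ (inj₂ (cong suc e))

∣p-q∣≤p : ∀ p q → q ≤ p + p → ∣ p - q ∣ ≤ p
∣p-q∣≤p p q q≤ with ≤-total p q
... | inj₁ p≤q = ≤-trans (≤-reflexive (m≤n⇒∣m-n∣≡n∸m p≤q)) (≤-trans (∸-monoˡ-≤ p q≤)
        (≤-reflexive (m+n∸n≡m p p)))
... | inj₂ q≤p = ≤-trans (≤-reflexive (m≤n⇒∣n-m∣≡n∸m q≤p)) (m∸n≤m p q)

side : Bool → Fin 3
side false = 1F
side true  = 2F

side≢0 : ∀ b → side b ≢ 0F
side≢0 false ()
side≢0 true  ()

side-not : ∀ b → side b ≢ side (not b)
side-not false ()
side-not true  ()

-- Leg i starts with color side (α i); its filler alternates with the other side if near i, and with the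
-- hub color 0 otherwise. The color inj₁ x replaces the filler of leg i at depth 3 + 3x + δ i x if
-- δ i x ≢ 2, and is absent from leg i if δ i x ≡ 2.
module Extremal {n t} (a : Fin n → ℕ) (long : ∀ i → 3 + t * 3 ≤ a i)
  (α near : Fin n → Bool) (δ : Fin n → Fin t → Fin 3)
  (label-injective : ∀ {i j} → α i ≡ α j → near i ≡ near j → (∀ x → δ i x ≡ δ j x) → i ≡ j)
  (witness : ∀ b → ∃[ i ] α i ≡ b) where

  filler : Bool → Bool → ℕ → Fin 3
  filler nr b p = alt p (if nr then side (not b) else 0F) (side b)

  pos : Fin n → Fin t → ℕ
  pos i x = 3 + toℕ (combine x (δ i x))

  Slot : Fin n → ℕ → Fin t → Set
  Slot i p x = p ≡ pos i x × δ i x ≢ 2F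

  slot? : ∀ i p → Dec (∃ (Slot i p))
  slot? i p = any? λ x → (p ≟ pos i x) ×-dec ¬? (δ i x ≟ᶠ 2F)

  legColor : Fin n → ℕ → Fin t ⊎ Fin 3
  legColor i p with slot? i p
  ... | yes (x , _) = inj₁ x
  ... | no _        = inj₂ (filler (near i) (α i) p)

  color : PalmV n a → Fin t ⊎ Fin 3
  color nothing        = inj₂ 0F
  color (just (i , j)) = legColor i (suc (toℕ j))

  slot-unique : ∀ {i p x y} → Slot i p x → Slot i p y → x ≡ y
  slot-unique {x = x} {y} (e , _) (e' , _) =
    combine-injectiveˡ x _ y _ (toℕ-injective (+-cancelˡ-≡ 3 _ _ (trans (sym e) e')))

  legColor-slot : ∀ {i p x} → Slot i p x → legColor i p ≡ inj₁ x
  legColor-slot {i} {p} s with slot? i p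
  ... | yes (y , s') = cong inj₁ (slot-unique s' s)
  ... | no none      = contradiction (_ , s) none

  legColor-filler : ∀ {i p} → ¬ ∃ (Slot i p) → legColor i p ≡ inj₂ (filler (near i) (α i) p)
  legColor-filler {i} {p} none with slot? i p
  ... | yes s = contradiction s none
  ... | no _  = refl

  legColor-inj₁ : ∀ {i p x} → legColor i p ≡ inj₁ x → Slot i p x
  legColor-inj₁ {i} {p} e with slot? i p
  legColor-inj₁ refl | yes (_ , s) = s

  legColor-inj₂ : ∀ {i p y} → legColor i p ≡ inj₂ y → y ≡ filler (near i) (α i) p
  legColor-inj₂ {i} {p} e with slot? i p
  legColor-inj₂ refl | no _ = refl

  slot⇒3≤ : ∀ {i p} → ∃ (Slot i p) → 3 ≤ p
  slot⇒3≤ (x , refl , _) = m≤m+n 3 _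

  noSlot : ∀ {i p} → p ≤ 2 → ¬ ∃ (Slot i p)
  noSlot p≤2 s = <⇒≱ (slot⇒3≤ s) p≤2

  -- The depth after digit 0 or 1 has digit 1 or 2 in the same block of three. A leg uses one digit
  -- per block and never 2.
  slot-nonconsecutive : ∀ {i p} → ∃ (Slot i p) → ¬ ∃ (Slot i (suc p))
  slot-nonconsecutive {i} (x , refl , ne) (y , e , ne') = go (δ i x) refl ne
    where
    e' : suc (toℕ (combine x (δ i x))) ≡ toℕ (combine y (δ i y))
    e' = +-cancelˡ-≡ 3 _ _ (trans (+-suc 3 _) e)
    absurd : ∀ d → toℕ d ≡ suc (toℕ (δ i x)) → d ≡ δ i y × x ≡ y
    absurd d d≡ = combine-injectiveʳ x d y _ eq , combine-injectiveˡ x d y _ eq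
      where
      eq : combine x d ≡ combine y (δ i y)
      eq = toℕ-injective (trans (toℕ-combine x d) (trans (cong (3 * toℕ x +_) d≡)
             (trans (+-suc _ _) (trans (cong suc (sym (toℕ-combine x (δ i x)))) e'))))
    go : ∀ d → δ i x ≡ d → d ≢ 2F → _
    go 0F δ≡ _ with absurd 1F (cong (suc ∘ toℕ) (sym δ≡))
    ... | 1≡ , refl with () ← trans 1≡ δ≡
    go 1F δ≡ _ with absurd 2F (cong (suc ∘ toℕ) (sym δ≡))
    ... | 2≡ , _ = ne' (sym 2≡)
    go 2F _ ne = ne refl

  at : ∀ i q → q < 3 + t * 3 → PalmV n a
  at i q lt = just (i , fromℕ< (≤-trans lt (long i)))

  depth-at : ∀ i q lt → depth (at i q lt) ≡ suc q
  depth-at i q lt = cong suc (toℕ-fromℕ< (≤-trans lt (long i)))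

  color-at : ∀ i q lt → color (at i q lt) ≡ legColor i (suc q)
  color-at i q lt = cong (legColor i) (depth-at i q lt)

  dist-at : ∀ {i} (j : Fin (a i)) q lt → dist (just (i , j)) (at i q lt) ≡ ∣ suc (toℕ j) - suc q ∣
  dist-at {i} j q lt = trans (dist-sameLeg a i j _) (cong (λ z → ∣ suc (toℕ j) - z ∣) (depth-at i q lt))

  filler-near≢0 : ∀ b p → filler true b p ≢ 0F
  filler-near≢0 b p e with alt-either p (side (not b)) (side b)
  ... | inj₁ e' = side≢0 (not b) (trans (sym e') e)
  ... | inj₂ e' = side≢0 b (trans (sym e') e)

  filler-far≢other : ∀ b p → filler false b p ≢ side (not b)
  filler-far≢other b p e with alt-either p 0F (side b)
  ... | inj₁ e' = side≢0 (not b) (sym (trans (sym e') e))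
  ... | inj₂ e' = side-not b (trans (sym e') e)

  firstColor : ∀ i lt → color (at i 0 lt) ≡ inj₂ (side (α i))
  firstColor i lt = trans (color-at i 0 lt) (legColor-filler {i} {1} (noSlot (s≤s z≤n)))

  near-noHub : ∀ {i w} → near i ≡ true → color w ≡ inj₂ 0F → leg w ≢ just i
  near-noHub {w = just (i , j)} nr e refl =
    filler-near≢0 (α i) (suc (toℕ j)) (sym (trans (legColor-inj₂ e) (cong (λ z → filler z (α i) (suc
            (toℕ j))) nr)))

  far-noOther : ∀ {i w} → near i ≡ false → color w ≡ inj₂ (side (not (α i))) → leg w ≢ just i × 1 ≤ depth w
  far-noOther {i} {nothing} _ e = contradiction (sym (inj₂-injective e)) (side≢0 (not (α i)))
  far-noOther {i} {w@(just (_ , j))} nr e = (λ { refl → filler-far≢other (α i) (suc (toℕ j))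
    (sym (trans (legColor-inj₂ e) (cong (λ z → filler z (α i) (suc (toℕ j))) nr))) }) , s≤s z≤n

  0<L : 0 < 3 + t * 3
  0<L = s≤s z≤n

  1<L : 1 < 3 + t * 3
  1<L = s≤s (s≤s z≤n)

  Dom : PalmV n a → PalmV n a → Set
  Dom = Dominates color

  -- A far leg and the hub both lack the opposite side, so v meets that color only beyond the hub;
  -- domination passes the bound on to u.
  far-bound : ∀ {u v i w} → leg v ≡ just i → near i ≡ false → color w ≡ inj₂ (side (not (α i))) →
              Dom u v → depth v < dist u w
  far-bound {u} {v} {i} {w} onv nr col u≥v with u≥v w
  ... | w' , col' , d with far-noOther {i} {w'} nr (trans col' col)
  ...   | off , 1≤ = ≤-trans (≤-trans (1+m≤m+n (depth v) 1≤)
            (≤-reflexive (sym (dist-apart {u = v} {w'} λ e → off (trans (sym e) onv))))) d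

  -- Depth can be read off the code: a near leg contains no 0, so the nearest one is no closer than the
  -- hub; a far leg lacks the side opposite to its own, which starts some other leg.
  depth-≤ : ∀ {u v} → Dom u v → depth v ≤ depth u
  depth-≤ {u} {nothing} _ = z≤n
  depth-≤ {u} {v@(just (i , _))} u≥v with near i in nr
  ... | true with u≥v nothing
  ...   | w' , col , d = ≤-trans (m≤m+n (depth v) (depth w'))
            (≤-trans (≤-reflexive (sym (dist-apart {u = v} {w'} (near-noHub {w = w'} nr col ∘ sym))))
              (≤-trans d (≤-reflexive (dist-hubʳ u))))
  depth-≤ {u} {v@(just (i , _))} u≥v | false with witness (not (α i))
  ... | ℓ , αℓ = s≤s⁻¹ (≤-trans (far-bound {u} {v} {i} {at ℓ 0 0<L} refl nr
            (trans (firstColor ℓ 0<L) (cong (inj₂ ∘ side) αℓ)) u≥v)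
          (≤-trans (dist≤depth+depth u (at ℓ 0 0<L))
            (≤-reflexive (trans (cong (depth u +_) (depth-at ℓ 0 0<L)) (+-comm (depth u) 1)))))

  -- The side missing from leg i' occurs on leg i at depth 1 if the first colors differ, and at
  -- depth 2 if leg i is near with the same first color. That is within `depth u` of u, against
  -- `far-bound`.
  far-excludes : ∀ {i i'} (j : Fin (a i)) (j' : Fin (a i')) → toℕ j ≡ toℕ j' → near i' ≡ false →
                 near i ≡ true ⊎ α i ≢ α i' → ¬ Dom (just (i , j)) (just (i' , j'))
  far-excludes {i} {i'} j j' jeq nr' cond u≥v = <⇒≱ (proj₂ (proj₂ (proj₂ (found cond)))) (≤-trans
          (proj₁ (proj₂ (proj₂ (found cond))))
      (≤-reflexive (cong suc jeq)))
    where
    u : PalmV n a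
    u = just (i , j)
    v : PalmV n a
    v = just (i' , j')
    visible : ∀ q lt → q ≤ 1 → color (at i q lt) ≡ inj₂ (side (not (α i'))) →
              ∃[ w ] (color w ≡ inj₂ (side (not (α i'))) × dist u w ≤ depth u × depth v < dist u w)
    visible q lt q≤1 col = at i q lt , col , ≤-trans (≤-reflexive (dist-at j q lt))
      (∣p-q∣≤p (suc (toℕ j)) (suc q) (≤-trans (s≤s q≤1) (+-mono-≤ (s≤s (z≤n {toℕ j})) (s≤s
              (z≤n {toℕ j}))))) ,
      far-bound {u} {v} {i'} {at i q lt} refl nr' col u≥v
    found : near i ≡ true ⊎ α i ≢ α i' →
            ∃[ w ] (color w ≡ inj₂ (side (not (α i'))) × dist u w ≤ depth u × depth v < dist u w)
    found cond with α i ≟ᵇ α i'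
    ... | no ne = visible 0 0<L z≤n (trans (firstColor i 0<L) (cong (inj₂ ∘ side) (¬-not ne)))
    found (inj₂ ne) | yes eq = contradiction eq ne
    found (inj₁ nr) | yes eq = visible 1 1<L ≤-refl (trans (color-at i 1 1<L)
            (trans (legColor-filler {i} {2} (noSlot ≤-refl))
              (cong inj₂ (trans (cong (λ z → filler z (α i) 2) nr) (cong (side ∘ not) eq)))))

  pos<L : ∀ i x → suc (suc (toℕ (combine x (δ i x)))) < 3 + t * 3
  pos<L i x = s≤s (≤-trans (s≤s (toℕ<n (combine x (δ i x)))) (n≤1+n _))

  pos-close : ∀ i i' x → δ i x ≢ 2F → pos i x ≤ suc (pos i' x)
  pos-close i i' x ne = +-monoʳ-≤ 3 (begin
    toℕ (combine x (δ i x))              ≡⟨ toℕ-combine x (δ i x) ⟩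
    3 * toℕ x + toℕ (δ i x)              ≤⟨ +-monoʳ-≤ (3 * toℕ x) (≤1 (δ i x) ne) ⟩
    3 * toℕ x + suc 0                    ≤⟨ +-monoʳ-≤ (3 * toℕ x) (s≤s z≤n) ⟩
    3 * toℕ x + suc (toℕ (δ i' x))       ≡⟨ +-suc (3 * toℕ x) (toℕ (δ i' x)) ⟩
    suc (3 * toℕ x + toℕ (δ i' x))       ≡⟨ cong suc (sym (toℕ-combine x (δ i' x))) ⟩
    suc (toℕ (combine x (δ i' x)))       ∎)
    where
    open ≤-Reasoning
    ≤1 : ∀ d → d ≢ 2F → toℕ d ≤ 1
    ≤1 0F _  = z≤n
    ≤1 1F _  = s≤s z≤n
    ≤1 2F ne = contradiction refl ne

  -- On a leg other than i', color x sits at most one depth higher up than on leg i. By `∣p-q∣<p+r`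
  -- this is too far from v, so the replacement lies on leg i'.
  slot-visible : ∀ {i i'} (j : Fin (a i)) (j' : Fin (a i')) → toℕ j ≡ toℕ j' →
                 Dom (just (i , j)) (just (i' , j')) → ∀ x → δ i x ≢ 2F →
                 δ i' x ≢ 2F × ∣ suc (toℕ j') - pos i' x ∣ ≤ ∣ suc (toℕ j') - pos i x ∣
  slot-visible {i} {i'} j j' jeq u≥v x ne with u≥v (at i _ (pos<L i x))
  ... | w , col , d = go w (trans col (trans (color-at i _ (pos<L i x))
          (legColor-slot {i} {_} {x} (refl , ne))))
          (≤-trans d (≤-reflexive (trans (dist-at j _ (pos<L i x)) (cong (λ z → ∣ suc z - pos i x ∣) jeq))))
    where
    go : ∀ w → color w ≡ inj₁ x → dist (just (i' , j')) w ≤ ∣ suc (toℕ j') - pos i x ∣ →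
         δ i' x ≢ 2F × ∣ suc (toℕ j') - pos i' x ∣ ≤ ∣ suc (toℕ j') - pos i x ∣
    go (just (i″ , j″)) e d with legColor-inj₁ {i″} e | i' ≟ᶠ i″
    ... | eq , ne' | yes refl = ne' , ≤-trans (≤-reflexive (cong (λ z → ∣ suc (toℕ j') - z ∣) (sym eq))) d
    ... | eq , _   | no _ = contradiction d (<⇒≱ (<-≤-trans (∣p-q∣<p+r (suc (toℕ j')) (s≤s z≤n)
            (s≤s z≤n) (pos-close i i″ x ne))
            (≤-reflexive (cong (suc (toℕ j') +_) (sym eq)))))

  -- Presence of x on the leg separates digit 2 from 0 and 1; these two mean consecutive depths,
  -- separated by parity.
  digits-agree : ∀ {i i'} (j : Fin (a i)) (j' : Fin (a i')) → toℕ j ≡ toℕ j' →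
                 Dom (just (i , j)) (just (i' , j')) → Dom (just (i' , j')) (just (i , j)) →
                 ∀ x → δ i x ≡ δ i' x
  digits-agree {i} {i'} j j' jeq u≥v v≥u x = go (δ i x) (δ i' x) refl refl
    where
    ≢2 : ∀ {d e} → d ≡ e → e ≢ 2F → d ≢ 2F
    ≢2 eq ne e = ne (trans (sym eq) e)
    same-dist : δ i x ≢ 2F → δ i' x ≢ 2F → ∣ suc (toℕ j') - pos i' x ∣ ≡ ∣ suc (toℕ j') - pos i x ∣
    same-dist ne ne' = ≤-antisym (proj₂ (slot-visible j j' jeq u≥v x ne))
      (subst (λ z → ∣ suc z - pos i x ∣ ≤ ∣ suc z - pos i' x ∣) jeq
              (proj₂ (slot-visible j' j (sym jeq) v≥u x ne')))
    pos-suc : ∀ i i' → δ i x ≡ 0F → δ i' x ≡ 1F → pos i' x ≡ suc (pos i x)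
    pos-suc i i' e e' = cong (3 +_) (trans (toℕ-combine x (δ i' x))
            (trans (cong (3 * toℕ x +_) (cong toℕ e'))
      (trans (+-suc (3 * toℕ x) 0) (cong suc (sym (trans (toℕ-combine x (δ i x))
              (cong (λ z → 3 * toℕ x + toℕ z) e)))))))
    go : ∀ d d' → δ i x ≡ d → δ i' x ≡ d' → δ i x ≡ δ i' x
    go 0F 0F e e' = trans e (sym e')
    go 1F 1F e e' = trans e (sym e')
    go 2F 2F e e' = trans e (sym e')
    go 0F 1F e e' = contradiction (trans (cong (λ z → ∣ suc (toℕ j') - z ∣) (sym (pos-suc i i' e e')))
      (same-dist (≢2 e λ ()) (≢2 e' λ ()))) (∣p-1+q∣≢∣p-q∣ (suc (toℕ j')) (pos i x))
    go 1F 0F e e' = contradiction (trans (cong (λ z → ∣ suc (toℕ j') - z ∣) (sym (pos-suc i' i e' e)))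
      (sym (same-dist (≢2 e λ ()) (≢2 e' λ ())))) (∣p-1+q∣≢∣p-q∣ (suc (toℕ j')) (pos i' x))
    go 0F 2F e e' = contradiction e' (proj₁ (slot-visible j j' jeq u≥v x (≢2 e λ ())))
    go 1F 2F e e' = contradiction e' (proj₁ (slot-visible j j' jeq u≥v x (≢2 e λ ())))
    go 2F 0F e e' = contradiction e (proj₁ (slot-visible j' j (sym jeq) v≥u x (≢2 e' λ ())))
    go 2F 1F e e' = contradiction e (proj₁ (slot-visible j' j (sym jeq) v≥u x (≢2 e' λ ())))

  near-filler-≢ : ∀ {i i'} → near i ≡ true → near i' ≡ true → α i ≢ α i' → ∀ p →
                  filler (near i) (α i) p ≢ filler (near i') (α i') p
  near-filler-≢ {i} {i'} nr nr' ne p rewrite nr | nr' | ¬-not ne | not-involutive (α i') =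
    alt-swap-≢ p (side-not (α i'))

  -- At a filler position the colors differ; at a slot both neighbors on the leg carry the same filler
  -- color, and it is not the same for i and i'.
  near-sides : ∀ {i i'} (j : Fin (a i)) (j' : Fin (a i')) → toℕ j ≡ toℕ j' →
               near i ≡ true → near i' ≡ true → (∀ x → δ i x ≡ δ i' x) →
               Dom (just (i , j)) (just (i' , j')) → α i ≡ α i'
  near-sides {i} {i'} j j' jeq nr nr' δeq u≥v with α i ≟ᵇ α i'
  ... | yes eq = eq
  ... | no ne = contradiction (slot? i p) absurd
    where
    p : ℕ
    p = suc (toℕ j)
    slot⇒ : ∀ {q} → ∃ (Slot i q) → ∃ (Slot i' q)
    slot⇒ (x , e , ne) = x , trans e (cong (λ z → 3 + toℕ (combine x z)) (δeq x)) , λ e' → ne (trans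
            (δeq x) e')
    slot⇐ : ∀ {q} → ∃ (Slot i' q) → ∃ (Slot i q)
    slot⇐ (x , e , ne) = x , trans e (cong (λ z → 3 + toℕ (combine x z))
            (sym (δeq x))) , λ e' → ne (trans (sym (δeq x)) e')
    -- The filler has period 2, so both neighbors of depth p carry the filler color of depth r =
    -- p-1.
    near-p : ∀ {q} → q ≡ p ⊎ suc q ≡ p ⊎ q ≡ suc p → ∀ {r} → suc r ≡ p → q ≢ p →
             filler (near i') (α i') q ≡ filler (near i') (α i') r
    near-p (inj₁ e)        _    ne = contradiction e ne
    near-p (inj₂ (inj₁ refl)) refl _ = refl
    near-p (inj₂ (inj₂ refl)) refl _ = refl
    absurd : ¬ Dec (∃ (Slot i p))
    absurd (no none) with u≥v (just (i , j))
    ... | w' , col , d = near-filler-≢ {i} {i'} nr nr' ne p (inj₂-injective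
            (trans (sym (legColor-filler {i} {p} none))
            (trans (sym col) (trans (cong color (sym v≡w')) (trans (cong (legColor i' ∘ suc) (sym jeq))
              (legColor-filler {i'} {p} (none ∘ slot⇐)))))))
      where
      v≡w' : just (i' , j') ≡ w'
      v≡w' = dist≡0⇒≡ (n≤0⇒n≡0 (≤-trans d (≤-reflexive (dist-refl (just (i , j))))))
    absurd (yes s) = step-back (toℕ j) refl
      where
      step-back : ∀ m → toℕ j ≢ m
      step-back zero e = noSlot (s≤s z≤n) (subst (λ z → ∃ (Slot i (suc z))) e s)
      step-back (suc m) e with u≥v (just (i , fromℕ< {m} (<-trans (≤-reflexive (sym e)) (toℕ<n j))))
      ... | w' , col , d = go w' (trans col col-w) (≤-trans d (≤-reflexive dist-w))
        where
        tm : toℕ (fromℕ< {m} (<-trans (≤-reflexive (sym e)) (toℕ<n j))) ≡ m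
        tm = toℕ-fromℕ< _
        col-w : legColor i (suc (toℕ (fromℕ< {m} (<-trans (≤-reflexive (sym e))
                (toℕ<n j))))) ≡ inj₂ (filler (near i) (α i) (suc m))
        col-w = trans (cong (legColor i ∘ suc) tm) (legColor-filler {i} {suc m} λ s' →
          slot-nonconsecutive s' (subst (λ z → ∃ (Slot i (suc z))) e s))
        dist-w : dist (just (i , j)) (just (i , fromℕ< {m} (<-trans (≤-reflexive (sym e)) (toℕ<n j)))) ≡ 1
        dist-w = trans (dist-sameLeg a i j _) (trans (cong₂ ∣_-_∣ e tm)
                (trans (cong ∣_- m ∣ (+-comm 1 m)) (trans (∣-∣-comm (m + 1) m) (∣m-m+n∣≡n m 1))))
        2≤depth : 2 ≤ suc (toℕ j')
        2≤depth = subst (λ z → 2 ≤ suc z) (trans (sym e) jeq) (s≤s (s≤s z≤n))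
        -- As v has depth at least 2, a vertex within 1 of v lies on leg i'; v itself is excluded,
        -- being a slot.
        go : ∀ w' → color w' ≡ inj₂ (filler (near i) (α i) (suc m)) → ¬ (dist (just (i' , j')) w' ≤ 1)
        go nothing _ d = <⇒≱ 2≤depth d
        go (just (i″ , j″)) c d with i' ≟ᶠ i″
        ... | no _ = <⇒≱ (≤-trans 2≤depth (m≤m+n _ _)) d
        ... | yes refl = near-filler-≢ {i} {i'} nr nr' ne (suc m) (trans (legColor-inj₂ {i'} c)
                (near-p (∣p-q∣≤1⇒ p (suc (toℕ j″)) (subst (λ z → ∣ z - toℕ j″ ∣ ≤ 1) (sym jeq) d))
                        (cong suc (sym e))
                  λ q≡p → noInj (trans (sym (legColor-slot {i'} {p} (proj₂ (slot⇒ s))))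
                          (trans (cong (legColor i') (sym q≡p)) c))))
          where
          noInj : ∀ {x y} → inj₁ x ≢ inj₂ y
          noInj ()

  -- Equal codes force, in turn, equal depths, equal digits, the same kind of filler and the same
  -- side; `label-injective` then identifies the legs.
  color-locating : Locating color
  color-locating = (hubLeg , legLeg) , loc
    where
    hubLeg : ∀ i (j : Fin (a i)) → toℕ j ≡ 0 → color nothing ≢ color (just (i , j))
    hubLeg i j e c = side≢0 (α i) (sym (inj₂-injective (trans c (trans (cong (legColor i ∘ suc) e)
      (legColor-filler {i} {1} (noSlot (s≤s z≤n)))))))
    legLeg : ∀ i (j j' : Fin (a i)) → toℕ j' ≡ suc (toℕ j) → color (just (i , j)) ≢ color (just (i , j'))
    legLeg i j j' e rewrite e = go (suc (toℕ j))
      where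
      filler-≢ : ∀ nr b p → filler nr b p ≢ filler nr b (suc p)
      filler-≢ true  b p = alt-swap-≢ p (side-not b ∘ sym)
      filler-≢ false b p = alt-swap-≢ p (side≢0 b ∘ sym)
      go : ∀ p → legColor i p ≢ legColor i (suc p)
      go p with slot? i p | slot? i (suc p)
      ... | yes s | yes s' = contradiction s' (slot-nonconsecutive s)
      ... | yes _ | no _   = λ ()
      ... | no _  | yes _  = λ ()
      ... | no _  | no _   = filler-≢ (near i) (α i) p ∘ inj₂-injective
    loc : ∀ u v → Dom u v → Dom v u → u ≡ v
    loc u v u≥v v≥u = go u v u≥v v≥u (≤-antisym (depth-≤ {v} {u} v≥u) (depth-≤ {u} {v} u≥v))
      where
      go : ∀ u v → Dom u v → Dom v u → depth u ≡ depth v → u ≡ v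
      go nothing nothing _ _ _ = refl
      go u@(just (i , j)) v@(just (i' , j')) u≥v v≥u deq =
        leg-depth-injective u v (cong just (same-leg (near i) (near i') refl refl)) deq
        where
        jeq : toℕ j ≡ toℕ j'
        jeq = suc-injective deq
        agree : ∀ x → δ i x ≡ δ i' x
        agree = digits-agree j j' jeq u≥v v≥u
        same-leg : ∀ b b' → near i ≡ b → near i' ≡ b' → i ≡ i'
        same-leg true true nr nr' = label-injective (near-sides j j' jeq nr nr' agree u≥v) (trans nr
                (sym nr')) agree
        same-leg true false nr nr' = contradiction u≥v (far-excludes j j' jeq nr' (inj₁ nr))
        same-leg false true nr nr' = contradiction v≥u (far-excludes j' j (sym jeq) nr (inj₁ nr'))
        same-leg false false nr nr' with α i ≟ᵇ α i'
        ... | yes eq = label-injective eq (trans nr (sym nr')) agree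
        ... | no ne  = contradiction u≥v (far-excludes j j' jeq nr' (inj₂ ne))

-- Labels for the legs of a palm with long legs

funToFin-cong : ∀ {m n} {f g : Fin m → Fin n} → (∀ x → f x ≡ g x) → funToFin f ≡ funToFin g
funToFin-cong {zero}  eq = refl
funToFin-cong {suc m} eq = cong₂ combine (eq zero) (funToFin-cong (eq ∘ suc))

finToFun-injective : ∀ {m n} {x y : Fin (n ^ m)} → (∀ i → finToFun {n} {m} x i ≡ finToFun y i) → x ≡ y
finToFun-injective {m} {n} {x} {y} eq =
  trans (sym (funToFin-finToFin {m} {n} x)) (trans (funToFin-cong eq) (funToFin-finToFin {m} {n} y))

-- Division of the leg number by 4 gives the label: the ternary digits of the quotient are δ and the
-- remainder selects the filler. Remainders 0 and 1 start with opposite sides, so legs 0 and 1 serve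
-- as `witness`.
hasLocating-extremal : ∀ {m t} (a : Fin (suc (suc m)) → ℕ) → suc (suc m) ≤ 4 * 3 ^ t →
                       (∀ i → 3 + t * 3 ≤ a i) → HasLocating (suc (suc m)) a (t + 3)
hasLocating-extremal {m} {t} a n≤ long =
  join t 3 ∘ color , locating-reflect join-injective color-locating
  where
  n≤' : suc (suc m) ≤ 3 ^ t * 4
  n≤' = ≤-trans n≤ (≤-reflexive (*-comm 4 (3 ^ t)))
  label : Fin (suc (suc m)) → Fin (3 ^ t) × Fin 4
  label i = remQuot 4 (inject≤ i n≤')
  α near : Fin 4 → Bool
  α 0F = false
  α 1F = true
  α 2F = false
  α 3F = true
  near 0F = true
  near 1F = true
  near 2F = false
  near 3F = false
  class-injective : ∀ {x y} → α x ≡ α y → near x ≡ near y → x ≡ y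
  class-injective {0F} {0F} _ _ = refl
  class-injective {1F} {1F} _ _ = refl
  class-injective {2F} {2F} _ _ = refl
  class-injective {3F} {3F} _ _ = refl
  class-injective {0F} {2F} _ ()
  class-injective {0F} {3F} () _
  class-injective {2F} {3F} () _
  class-injective {1F} {3F} _ ()
  class-injective {2F} {0F} _ ()
  class-injective {3F} {1F} _ ()
  label-injective : ∀ {i j} → α (proj₂ (label i)) ≡ α (proj₂ (label j)) →
    near (proj₂ (label i)) ≡ near (proj₂ (label j)) →
    (∀ x → finToFun {3} {t} (proj₁ (label i)) x ≡ finToFun (proj₁ (label j)) x) → i ≡ j
  label-injective {i} {j} αeq neq δeq = inject≤-injective n≤' n≤' i j
    (trans (sym (combine-remQuot {3 ^ t} 4 (inject≤ i n≤')))
      (trans (cong₂ combine (finToFun-injective {t} {3} δeq) (class-injective αeq neq))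
        (combine-remQuot {3 ^ t} 4 (inject≤ j n≤'))))
  class-of : ∀ i (r : Fin 4) → toℕ i ≡ toℕ r → proj₂ (label i) ≡ r
  class-of i r eq = trans (cong (proj₂ ∘ remQuot {3 ^ t} 4) (toℕ-injective (trans (toℕ-inject≤ i n≤')
      (trans eq (sym (trans (toℕ-combine q₀ r) (cong (λ z → 4 * z + toℕ r) (toℕ-fromℕ< (m^n>0 3 t)))))))))
    (cong proj₂ (remQuot-combine {3 ^ t} q₀ r))
    where
    q₀ : Fin (3 ^ t)
    q₀ = fromℕ< (m^n>0 3 t)
  witness : ∀ b → ∃[ i ] α (proj₂ (label i)) ≡ b
  witness false = 0F , cong α (class-of 0F 0F refl)
  witness true  = 1F , cong α (class-of 1F 1F refl)
  open Extremal a long (α ∘ proj₂ ∘ label) (near ∘ proj₂ ∘ label) (finToFun ∘ proj₁ ∘ label) label-injective witness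
  join-injective : ∀ {x y : Fin t ⊎ Fin 3} → join t 3 x ≡ join t 3 y → x ≡ y
  join-injective {x} {y} eq =
    trans (sym (splitAt-join t 3 x)) (trans (cong (splitAt t) eq) (splitAt-join t 3 y))

-- Intermediate values

-- A path of palms from the star at m = 0 to all legs long at m = n; consecutive ones differ only in
-- leg m.
interpolate : ℕ → ℕ → Fin n → ℕ
interpolate l m i = if toℕ i <ᵇ m then l else 1

interpolate-pos : ∀ {l} → 1 ≤ l → ∀ m (i : Fin n) → 1 ≤ interpolate l m i
interpolate-pos 1≤l m i with toℕ i <ᵇ m
... | true  = 1≤l
... | false = ≤-refl

<ᵇ-suc : ∀ {p m} → p ≢ m → (p <ᵇ suc m) ≡ (p <ᵇ m)
<ᵇ-suc {zero}  {zero}  ne = contradiction refl ne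
<ᵇ-suc {zero}  {suc m} ne = refl
<ᵇ-suc {suc p} {zero}  ne = refl
<ᵇ-suc {suc p} {suc m} ne = <ᵇ-suc (ne ∘ cong suc)

interpolate-full : ∀ l (i : Fin n) → interpolate l n i ≡ l
interpolate-full l zero    = refl
interpolate-full l (suc i) = interpolate-full l i

-- Shortening leg m back to length 1 costs one color at most, so passing from m to m+1 lowers χ_L by
-- at most 1.
interpolate-step : ∀ {m l} → 1 ≤ l → m < suc (suc n) →
                   HasLocating (suc (suc n)) (interpolate l (suc m)) k →
                   HasLocating (suc (suc n)) (interpolate l m) (suc k)
interpolate-step {n} {k} {m} {l} 1≤l m<n (c , c-loc) with otherLeg (fromℕ< m<n)
... | ℓ , i₀≢ℓ = _ , locating-reflect maybeToFin-injective
      (recolor-locating {i₀ = fromℕ< m<n} {ℓ} (i₀≢ℓ ∘ sym) (pos _) (pos ℓ) same c-loc)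
  where
  pos : ∀ i → 1 ≤ interpolate l m i
  pos = interpolate-pos 1≤l m
  same : ∀ i → i ≢ fromℕ< m<n → interpolate l (suc m) i ≡ interpolate l m i
  same i ne = cong (if_then l else 1)
    (<ᵇ-suc λ e → ne (toℕ-injective (trans e (sym (toℕ-fromℕ< m<n)))))

module _ {n t k} (n≤ : suc (suc n) ≤ 4 * 3 ^ t) (t+3≤k : t + 3 ≤ k) where

  private
    N l : ℕ
    N = suc (suc n)
    l = 3 + t * 3

    pos : ∀ m (i : Fin N) → 1 ≤ interpolate l m i
    pos = interpolate-pos (s≤s z≤n)

    full : HasLocating N (interpolate l N) (t + 3)
    full = hasLocating-extremal {t = t} _ n≤ λ i → ≤-reflexive (sym (interpolate-full l i))

    Attained : Set
    Attained = Σ[ a ∈ (Fin N → ℕ) ] ((∀ i → 1 ≤ a i) × IsLocChromNum (Palm N a) k)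

  -- A discrete intermediate value argument with the invariant χ_L ≥ k. If χ_L > k, the next palm
  -- still has χ_L ≥ k; at m = `N` the extremal coloring gives χ_L ≤ t+3 ≤ k, so equality occurs on
  -- the way.
  intermediate : ∀ d m → d + m ≡ N → (∀ k' → HasLocating N (interpolate l m) k' → k ≤ k') → Attained
  intermediate d m eq k≤ = go d eq (chromNum (hasLocating-n+1 _ (pos m)))
    where
    go : ∀ d → d + m ≡ N → Chromatic N (interpolate l m) → Attained
    go d eq (χ , isχ , has , min) = decide (χ ≟ k)
      where
      next : ∀ d → d + m ≡ N → k < χ → Attained
      next zero    refl k<χ = contradiction (≤-trans (min _ full) t+3≤k) (<⇒≱ k<χ)
      next (suc d) eq   k<χ = intermediate d (suc m) (trans (+-suc d m) eq) λ k' has' →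
        s≤s⁻¹ (≤-trans k<χ (min _ (interpolate-step (s≤s z≤n)
          (≤-trans (s≤s (m≤n+m m d)) (≤-reflexive eq)) has')))
      decide : Dec (χ ≡ k) → Attained
      decide (yes χ≡k) = interpolate l m , pos m , subst (IsLocChromNum _) χ≡k isχ
      decide (no χ≢k)  = next d eq (≤∧≢⇒< (k≤ χ has) (χ≢k ∘ sym))

theorem7 : (n : ℕ) → 2 ≤ n → (t : ℕ) → IsCeilLog3Quarter n t →
    ((a : Fin n → ℕ) → (∀ i → 1 ≤ a i) →
    Σ[ k ∈ ℕ ] (IsLocChromNum (Palm n a) k × t + 3 ≤ k × k ≤ n + 1))
    × ((k : ℕ) → t + 3 ≤ k → k ≤ n + 1 →
    Σ[ a ∈ (Fin n → ℕ) ] ((∀ i → 1 ≤ a i) × IsLocChromNum (Palm n a) k))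
theorem7 n@(suc (suc n')) 2≤n t (n≤ , large) = bounds , attained
  where
  bounds : (a : Fin n → ℕ) → (∀ i → 1 ≤ a i) →
           Σ[ k ∈ ℕ ] (IsLocChromNum (Palm n a) k × t + 3 ≤ k × k ≤ n + 1)
  bounds a pos = case chromNum (hasLocating-n+1 a pos) of λ where
    (χ , isχ , has , min) → χ , isχ , chromatic-lower 2≤n large pos has ,
      ≤-trans (min _ (hasLocating-n+1 a pos)) (≤-reflexive (+-comm 1 n))
  attained : (k : ℕ) → t + 3 ≤ k → k ≤ n + 1 →
             Σ[ a ∈ (Fin n → ℕ) ] ((∀ i → 1 ≤ a i) × IsLocChromNum (Palm n a) k)
  -- The path starts at the star, whose locating colorings use at least n+1 ≥ k colors.
  attained k t+3≤k k≤n+1 = intermediate {t = t} n≤ t+3≤k n 0 (+-identityʳ n) λ k' has →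
    ≤-trans k≤n+1 (≤-trans (≤-reflexive (+-comm n 1)) (star-chromatic (λ _ → refl) has))
theorem7 (suc zero) (s≤s ())
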